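{- Let $l_1,l_2,l_3$ be positive integers with $l_1=\min\{l_1,l_2,l_3\}$, $l_2\ge 2$ and $l_3\ge 2$, and let $G=\Theta(l_1,l_2,l_3)$. Then $G$ is not enumeratively chromatic-choosable if and only if $l_1,l_2,l_3$ all have the same parity and $\{l_1,l_2,l_3\}\neq\{2\}$.
   Context: All graphs are finite and simple. For positive integers $l_1,l_2,l_3$, the theta graph $\Theta(l_1,l_2,l_3)$ consists of two end vertices joined by three internally disjoint paths of lengths (numbers of edges) $l_1,l_2,l_3$. A list assignment $L$ for a graph $G$ assigns to each vertex $v$ a set $L(v)$ of colors; it is an $m$-assignment if $|L(v)|=m$ for all $v$. A proper $L$-coloring is a proper coloring $f$ with $f(v)\in L(v)$ for all $v$, and $P(G,L)$ is the number of proper $L$-colorings. For $m\in\mathbb{N}$, the chromatic polynomial $P(G,m)$ is the number of proper colorings of $G$ with colors from $\{1,\dots,m\}$, and the list color function $P_\ell(G,m)$ is the minimum of $P(G,L)$ over all $m$-assignments $L$ for $G$. A graph $G$ is enumeratively chromatic-choosable if $P_\ell(G,m)=P(G,m)$ for every $m\in\mathbb{N}$. -}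

module Defs where

open import Data.Bool using (if_then_else_; T; true; false)
open import Data.Fin using (Fin; zero; suc; toℕ)
open import Data.Fin.Properties using (all?)
open import Data.List using (List; []; _∷_; length; filter; cartesianProductWith; applyUpTo)
open import Data.List.Relation.Unary.Unique.Propositional using (Unique)
open import Data.Nat using (ℕ; zero; suc; pred; _+_; _≤_; _<_; _≡ᵇ_; _≟_; NonZero)
open import Data.Nat.Properties using (anyUpTo?; <⇒≢; ≡ᵇ⇒≡; 1+n≢n; +-suc)
open import Data.Product using (∃; _×_; _,_)
open import Data.Sum using (_⊎_; inj₁; inj₂; [_,_]; map; swap)
open import Data.Unit using (tt)
open import Data.Vec as Vec using (Vec; lookup)
open import Function using (_∘_)
open import Relation.Binary using (Rel; Decidable; Symmetric)
open import Relation.Binary.PropositionalEquality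
  using (_≡_; _≢_; refl; sym; trans; subst)
open import Relation.Nullary using (¬_; Dec; contradiction)
open import Relation.Nullary.Decidable using (_×-dec_; _⊎-dec_; _→-dec_; ¬?)
open import Relation.Unary using (Pred)
open import Level using (0ℓ)

record Graph : Set₁ where
  field
    order   : ℕ
    Adj     : Rel (Fin order) 0ℓ
    adj?    : Decidable Adj
    adj-sym : Symmetric Adj
    irrefl  : ∀ v → ¬ Adj v v

-- Colours are natural numbers, and a finite set of colours is a list of
-- natural numbers without repetition.
module _ (G : Graph) where
  open Graph G

  ListAssignment : Set
  ListAssignment = Fin order → List ℕ

  IsAssignment : ℕ → ListAssignment → Set
  IsAssignment m L = ∀ v → Unique (L v) × length (L v) ≡ m

  Proper : Vec ℕ order → Set
  Proper f = ∀ u v → Adj u v → lookup f u ≢ lookup f v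

  proper? : ∀ f → Dec (Proper f)
  proper? f = all? λ u → all? λ v → adj? u v →-dec ¬? (lookup f u ≟ lookup f v)

-- All vectors f with f(i) ∈ L(i) for every i; each occurs exactly once if every
-- L(i) is free of repetitions.
choices : ∀ {n} → (Fin n → List ℕ) → List (Vec ℕ n)
choices {zero}  L = Vec.[] ∷ []
choices {suc n} L = cartesianProductWith Vec._∷_ (L zero) (choices (L ∘ suc))

-- P(G, L)
#colourings : (G : Graph) → ListAssignment G → ℕ
#colourings G L = length (filter (proper? G) (choices L))

-- P(G, m), counting proper colourings with colours from {1, …, m}
chromaticPolynomial : Graph → ℕ → ℕ
chromaticPolynomial G m = #colourings G λ _ → applyUpTo suc m

IsMinimum : Pred ℕ 0ℓ → ℕ → Set
IsMinimum S k = S k × (∀ j → S j → k ≤ j)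

-- The relation Pℓ(G, m) = k.  Pℓ is a minimum over infinitely many list
-- assignments, so it is given as a relation; at most one k satisfies it.
ListColourFunction : Graph → ℕ → ℕ → Set
ListColourFunction G m =
  IsMinimum λ k → ∃ λ L → IsAssignment G m L × #colourings G L ≡ k

EnumerativelyChromaticChoosable : Graph → Set
EnumerativelyChromaticChoosable G =
  ∀ m → ListColourFunction G m (chromaticPolynomial G m)

-- The j-th vertex, 0 ≤ j ≤ l, of a path of length l in a theta graph.  The end
-- vertices are 0 and 1, and the interior vertices of the path are numbered
-- consecutively after the o interior vertices of the preceding paths.
pathVertex : (o l : ℕ) → ℕ → ℕ
pathVertex o l zero    = 0
pathVertex o l (suc j) = if suc j ≡ᵇ l then 1 else 2 + (o + j)

PathEdge : (o l : ℕ) → Rel ℕ 0ℓ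
PathEdge o l x y = ∃ λ j → j < l ×
  ((x ≡ pathVertex o l j × y ≡ pathVertex o l (suc j)) ⊎
   (y ≡ pathVertex o l j × x ≡ pathVertex o l (suc j)))

pathEdge? : ∀ o l → Decidable (PathEdge o l)
pathEdge? o l x y = anyUpTo? (λ j →
  ((x ≟ pathVertex o l j) ×-dec (y ≟ pathVertex o l (suc j))) ⊎-dec
  ((y ≟ pathVertex o l j) ×-dec (x ≟ pathVertex o l (suc j)))) l

pathEdge-sym : ∀ o l → Symmetric (PathEdge o l)
pathEdge-sym o l (j , j<l , e) = j , j<l , swap e

pathVertex-step : ∀ o l j → j < l → pathVertex o l j ≢ pathVertex o l (suc j)
pathVertex-step o l zero _ with 1 ≡ᵇ l
... | true  = λ ()
... | false = λ ()
pathVertex-step o l (suc j) j<l with suc j ≡ᵇ l in eq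
... | true = contradiction (≡ᵇ⇒≡ (suc j) l (subst T (sym eq) tt)) (<⇒≢ j<l)
... | false with suc (suc j) ≡ᵇ l
...   | true  = λ ()
...   | false = λ p → 1+n≢n (sym (trans (drop2 p) (+-suc o j)))
  where
  drop2 : ∀ {a b} → 2 + a ≡ 2 + b → a ≡ b
  drop2 refl = refl

pathEdge-irrefl : ∀ o l x → ¬ PathEdge o l x x
pathEdge-irrefl o l x (j , j<l , e) =
  [ (λ (p , q) → pathVertex-step o l j j<l (trans (sym p) q))
  , (λ (p , q) → pathVertex-step o l j j<l (trans (sym p) q)) ] e

-- Θ(l₁, l₂, l₃) as a simple graph: if two of the lengths are 1, the two paths
-- share their single edge.
Θ : (l₁ l₂ l₃ : ℕ) .{{_ : NonZero l₁}} .{{_ : NonZero l₂}} .{{_ : NonZero l₃}} → Graph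
Θ l₁ l₂ l₃ = record
  { order   = 2 + (pred l₁ + (pred l₂ + pred l₃))
  ; Adj     = λ u v → E (toℕ u) (toℕ v)
  ; adj?    = λ u v → pathEdge? o₁ l₁ (toℕ u) (toℕ v) ⊎-dec
                      (pathEdge? o₂ l₂ (toℕ u) (toℕ v) ⊎-dec
                       pathEdge? o₃ l₃ (toℕ u) (toℕ v))
  ; adj-sym = map (pathEdge-sym o₁ l₁) (map (pathEdge-sym o₂ l₂) (pathEdge-sym o₃ l₃))
  ; irrefl  = λ v → [ pathEdge-irrefl o₁ l₁ (toℕ v)
                    , [ pathEdge-irrefl o₂ l₂ (toℕ v)
                      , pathEdge-irrefl o₃ l₃ (toℕ v) ] ]
  }
  where
  o₁ o₂ o₃ : ℕ
  o₁ = 0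
  o₂ = pred l₁
  o₃ = pred l₁ + pred l₂

  E : Rel ℕ 0ℓ
  E x y = PathEdge o₁ l₁ x y ⊎ (PathEdge o₂ l₂ x y ⊎ PathEdge o₃ l₃ x y)

{-# OPTIONS --safe #-}
module Submission where

-- Summing over the colours of the two end vertices, P(Θ, L) = Σ N₁ N₂ N₃ (a, b),
-- where Nᵢ (a, b) counts the colourings of the i-th path between ends coloured
-- a and b.  With m colours and equal lists, Nᵢ is K l (a, b) = d l or o l as
-- a = b or a ≠ b, where d l = o l + 1 for even l and o l = d l + 1 for odd l.
-- For arbitrary lists each row of Nᵢ still dominates such a row, with the
-- diagonal entry possibly displaced.
--
-- Different parities: two of the paths form an even cycle, which has at least as
-- many colourings as with equal lists (if two adjacent lists differ, a colour
-- missing from one of them gains more than all displacements lose, for m ≥ 3;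
-- for m = 2 there is no colouring with equal lists).  The third path has the
-- other parity, so K l for it is a constant plus a 0-1 term; the entries at which
-- that term is 1 contribute at least the minimum of the product over the cycle,
-- and that minimum is what equal lists attain there.
--
-- Θ(2, 2, 2): with n = m - 2, the pairs of equal end colours that are lost when
-- the end lists differ are compensated by the colours missing from the middle
-- lists; m = 2 is a finite check.
--
-- Equal parities: at m = 2 there are two colourings with equal lists, and lists
-- that force a detour on the long paths leave at most one.

open import Defs
open import Data.Bool using (Bool; true; false; if_then_else_; T; _∧_; _∨_; not)
open import Data.Bool.Properties using (T-∧)
open import Data.Empty using (⊥-elim)
open import Data.Fin using (Fin; zero; suc; toℕ; fromℕ<; _↑ˡ_; _↑ʳ_; splitAt)
open import Data.Fin.Properties using (toℕ-fromℕ<)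
open import Data.List using (List; []; _∷_; length; filter; map; _++_; cartesianProductWith; applyUpTo)
open import Data.List.Membership.Propositional using (_∈_; _∉_; find)
open import Data.List.Relation.Unary.All.Properties using (¬All⇒Any¬)
open import Data.List.Properties using (map-++; map-∘; length-applyUpTo)
open import Data.List.Relation.Unary.All as All using (All; []; _∷_)
open import Data.List.Relation.Unary.AllPairs using ([]; _∷_)
open import Data.List.Relation.Unary.Any using (here; there)
open import Data.List.Relation.Unary.Unique.Propositional using (Unique)
open import Data.List.Relation.Unary.Unique.Propositional.Properties using (applyUpTo⁺₁)
open import Data.Nat
  using (ℕ; zero; suc; _+_; _*_; _∸_; _⊓_; _≤_; _<_; _≥_; z≤n; s≤s; s≤s⁻¹; _≡ᵇ_; _≤ᵇ_; _≟_; NonZero; ≢-nonZero⁻¹; parity)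
open import Data.List.Membership.DecPropositional _≟_ using (_∈?_)
open import Data.Nat.ListAction using (sum)
open import Data.Nat.ListAction.Properties using (sum-++)
open import Data.Nat.Properties
open import Data.Nat.Tactic.RingSolver using (solve-∀)
open import Data.Parity using (0ℙ; 1ℙ; _⁻¹) renaming (_≟_ to _ℙ≟_)
open import Data.Parity.Properties using (+-homo-+; suc-homo-⁻¹; p+p≡0ℙ)
open import Data.Product using (∃; _×_; _,_; proj₁; proj₂)
open import Data.Sum using (_⊎_; inj₁; inj₂; [_,_]′; swap)
open import Data.Unit using (tt)
open import Data.Vec as Vec using (Vec; lookup)
open import Data.Vec.Functional as Vector using () renaming (_∷_ to _◂_)
open import Data.Vec.Functional.Properties using (lookup-++ˡ; lookup-++ʳ)
open import Function using (_∘_; id)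
open import Function.Bundles using (_⇔_; mk⇔; Equivalence)
open import Relation.Binary.PropositionalEquality
  using (_≡_; _≢_; refl; sym; trans; cong; cong₂; subst; subst₂; _≗_)
open import Relation.Nullary using (¬_; Dec; yes; no; does; contradiction)
open import Relation.Nullary.Decidable using (¬?; _×-dec_; _⊎-dec_; dec-true; dec-false; decidable-stable)

private variable
  A B X Y : Set

-- Finite sums over lists and indicators of decidable propositions.

∑ : List A → (A → ℕ) → ℕ
∑ xs f = sum (map f xs)

⟦_⟧ : Dec X → ℕ
⟦ x? ⟧ = if does x? then 1 else 0

⟦⟧-true : (x? : Dec X) → X → ⟦ x? ⟧ ≡ 1
⟦⟧-true x? x rewrite dec-true x? x = refl

⟦⟧-false : (x? : Dec X) → ¬ X → ⟦ x? ⟧ ≡ 0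
⟦⟧-false x? ¬x rewrite dec-false x? ¬x = refl

⟦⟧-⇔ : (x? : Dec X) (y? : Dec Y) → X ⇔ Y → ⟦ x? ⟧ ≡ ⟦ y? ⟧
⟦⟧-⇔ (yes x) y? e = sym (⟦⟧-true y? (Equivalence.to e x))
⟦⟧-⇔ (no ¬x) y? e = sym (⟦⟧-false y? (¬x ∘ Equivalence.from e))

⟦⟧-× : (x? : Dec X) (y? : Dec Y) → ⟦ x? ×-dec y? ⟧ ≡ ⟦ x? ⟧ * ⟦ y? ⟧
⟦⟧-× (yes _) (yes _) = refl
⟦⟧-× (yes _) (no _)  = refl
⟦⟧-× (no _)  _       = refl

length-filter-∑ : {P : A → Set} (P? : ∀ x → Dec (P x)) (xs : List A) →
                  length (filter P? xs) ≡ ∑ xs (λ x → ⟦ P? x ⟧)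
length-filter-∑ P? []       = refl
length-filter-∑ P? (x ∷ xs) with P? x
... | yes _ = cong suc (length-filter-∑ P? xs)
... | no  _ = length-filter-∑ P? xs

∑-cong∈ : (xs : List A) {f g : A → ℕ} → (∀ {x} → x ∈ xs → f x ≡ g x) → ∑ xs f ≡ ∑ xs g
∑-cong∈ []       _ = refl
∑-cong∈ (x ∷ xs) h = cong₂ _+_ (h (here refl)) (∑-cong∈ xs (h ∘ there))

∑-cong : (xs : List A) {f g : A → ℕ} → f ≗ g → ∑ xs f ≡ ∑ xs g
∑-cong xs h = ∑-cong∈ xs (λ {x} _ → h x)

∑-mono : (xs : List A) {f g : A → ℕ} → (∀ {x} → x ∈ xs → f x ≤ g x) → ∑ xs f ≤ ∑ xs g
∑-mono []       _ = z≤n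
∑-mono (x ∷ xs) h = +-mono-≤ (h (here refl)) (∑-mono xs (h ∘ there))

∑-++ : (xs ys : List A) (f : A → ℕ) → ∑ (xs ++ ys) f ≡ ∑ xs f + ∑ ys f
∑-++ xs ys f rewrite map-++ f xs ys = sum-++ (map f xs) (map f ys)

∑-map : (h : A → B) (xs : List A) (f : B → ℕ) → ∑ (map h xs) f ≡ ∑ xs (f ∘ h)
∑-map h xs f = cong sum (sym (map-∘ xs))

∑-+ : (xs : List A) (f g : A → ℕ) → ∑ xs (λ x → f x + g x) ≡ ∑ xs f + ∑ xs g
∑-+ []       f g = refl
∑-+ (x ∷ xs) f g rewrite ∑-+ xs f g = interchange (f x) (g x) (∑ xs f) (∑ xs g)
  where
  interchange : ∀ a b c d → a + b + (c + d) ≡ a + c + (b + d)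
  interchange = solve-∀

∑-*ˡ : (xs : List A) (n : ℕ) (f : A → ℕ) → ∑ xs (λ x → n * f x) ≡ n * ∑ xs f
∑-*ˡ []       n f = sym (*-zeroʳ n)
∑-*ˡ (x ∷ xs) n f rewrite ∑-*ˡ xs n f = sym (*-distribˡ-+ n (f x) (∑ xs f))

∑-*ʳ : (xs : List A) (n : ℕ) (f : A → ℕ) → ∑ xs (λ x → f x * n) ≡ ∑ xs f * n
∑-*ʳ xs n f = trans (∑-cong xs (λ x → *-comm (f x) n)) (trans (∑-*ˡ xs n f) (*-comm n _))

∑-const : (xs : List A) (n : ℕ) → ∑ xs (λ _ → n) ≡ length xs * n
∑-const []       n = refl
∑-const (x ∷ xs) n = cong (n +_) (∑-const xs n)

∑-zero : (xs : List A) → ∑ xs (λ _ → 0) ≡ 0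
∑-zero xs = trans (∑-const xs 0) (*-zeroʳ (length xs))

∑-comm : (xs : List A) (ys : List B) (f : A → B → ℕ) →
         ∑ xs (λ x → ∑ ys (f x)) ≡ ∑ ys (λ y → ∑ xs (λ x → f x y))
∑-comm []       ys f = sym (∑-zero ys)
∑-comm (x ∷ xs) ys f rewrite ∑-comm xs ys f = sym (∑-+ ys (f x) (λ y → ∑ xs (λ x′ → f x′ y)))

∑-cartesianProductWith : {C : Set} (h : A → B → C) (xs : List A) (ys : List B) (f : C → ℕ) →
  ∑ (cartesianProductWith h xs ys) f ≡ ∑ xs (λ x → ∑ ys (λ y → f (h x y)))
∑-cartesianProductWith h []       ys f = refl
∑-cartesianProductWith h (x ∷ xs) ys f
  rewrite ∑-++ (map (h x) ys) (cartesianProductWith h xs ys) f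
  = cong₂ _+_ (∑-map (h x) ys f) (∑-cartesianProductWith h xs ys f)

∑-choices-++ : ∀ p q (M : Fin (p + q) → List ℕ) (f : Vec ℕ (p + q) → ℕ) →
  ∑ (choices M) f ≡
  ∑ (choices (M ∘ (_↑ˡ q))) (λ v → ∑ (choices (M ∘ (p ↑ʳ_))) (λ w → f (v Vec.++ w)))
∑-choices-++ zero    q M f = sym (+-identityʳ _)
∑-choices-++ (suc p) q M f =
  trans (∑-cartesianProductWith Vec._∷_ (M zero) _ f)
  (trans (∑-cong (M zero) (λ x → ∑-choices-++ p q (M ∘ suc) (f ∘ (x Vec.∷_))))
         (sym (∑-cartesianProductWith Vec._∷_ (M zero) _ _)))

-- Path colourings and the factorisation of the colouring count of a theta graph.

infix 8 _≠ⁿ_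
_≠ⁿ_ : ℕ → ℕ → ℕ
a ≠ⁿ b = ⟦ ¬? (a ≟ b) ⟧

≠ⁿ-≢ : ∀ {a b} → a ≢ b → a ≠ⁿ b ≡ 1
≠ⁿ-≢ {a} {b} = ⟦⟧-true (¬? (a ≟ b))

≠ⁿ-refl : ∀ a → a ≠ⁿ a ≡ 0
≠ⁿ-refl a = ⟦⟧-false (¬? (a ≟ a)) (λ ne → ne refl)

≠ⁿ-sym : ∀ a b → a ≠ⁿ b ≡ b ≠ⁿ a
≠ⁿ-sym a b = ⟦⟧-⇔ (¬? (a ≟ b)) (¬? (b ≟ a)) (mk⇔ (_∘ sym) (_∘ sym))

-- The number of proper list colourings of the interior of a path whose end
-- vertices are coloured a and b.
pathColourings : ∀ {p} → (Fin p → List ℕ) → ℕ → ℕ → ℕ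
pathColourings {zero}  M a b = a ≠ⁿ b
pathColourings {suc p} M a b = ∑ (M zero) (λ c → a ≠ⁿ c * pathColourings (M ∘ suc) c b)

Walk : ∀ {p} → ℕ → Vec ℕ p → ℕ → Set
Walk a Vec.[]      b = a ≢ b
Walk a (c Vec.∷ w) b = a ≢ c × Walk c w b

walk? : ∀ {p} a (w : Vec ℕ p) b → Dec (Walk a w b)
walk? a Vec.[]      b = ¬? (a ≟ b)
walk? a (c Vec.∷ w) b = ¬? (a ≟ c) ×-dec walk? c w b

∑-walks : ∀ {p} (M : Fin p → List ℕ) a b →
          ∑ (choices M) (λ w → ⟦ walk? a w b ⟧) ≡ pathColourings M a b
∑-walks {zero}  M a b = +-identityʳ _
∑-walks {suc p} M a b =
  trans (∑-cartesianProductWith Vec._∷_ (M zero) _ _)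
        (∑-cong (M zero) λ c →
          trans (∑-cong (choices (M ∘ suc)) (λ w → ⟦⟧-× (¬? (a ≟ c)) (walk? c w b)))
          (trans (∑-*ˡ (choices (M ∘ suc)) (a ≠ⁿ c) _)
                 (cong (a ≠ⁿ c *_) (∑-walks (M ∘ suc) c b))))

-- The entry at position i, with junk value 0 out of range.
at : ∀ {n} → Vec ℕ n → ℕ → ℕ
at Vec.[]      _       = 0
at (x Vec.∷ _) zero    = x
at (_ Vec.∷ v) (suc i) = at v i

lookup-at : ∀ {n} (v : Vec ℕ n) i → lookup v i ≡ at v (toℕ i)
lookup-at (x Vec.∷ v) zero    = refl
lookup-at (x Vec.∷ v) (suc i) = lookup-at v i

at-++ˡ : ∀ {p q} (v : Vec ℕ p) (w : Vec ℕ q) {i} → i < p → at (v Vec.++ w) i ≡ at v i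
at-++ˡ (x Vec.∷ v) w {zero}  _   = refl
at-++ˡ (x Vec.∷ v) w {suc i} i<p = at-++ˡ v w (s≤s⁻¹ i<p)

at-++ʳ : ∀ {p q} (v : Vec ℕ p) (w : Vec ℕ q) i → at (v Vec.++ w) (p + i) ≡ at w i
at-++ʳ Vec.[]      w i = refl
at-++ʳ (x Vec.∷ v) w i = at-++ʳ v w i

-- Here `s` is the sequence of colours along the whole path, ends included, so only its inner values
-- have to agree with `w`. Each induction step drops the first edge.
walk⇔ : ∀ {p} (w : Vec ℕ p) (s : ℕ → ℕ) → (∀ {i} → i < p → s (suc i) ≡ at w i) →
        (∀ {j} → j < suc p → s j ≢ s (suc j)) ⇔ Walk (s 0) w (s (suc p))
walk⇔ Vec.[] s h = mk⇔ (λ f → f (s≤s z≤n)) (λ { ne {zero} _ → ne ; ne {suc _} (s≤s ()) })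
walk⇔ (c Vec.∷ w) s h with h (s≤s z≤n)
... | refl = mk⇔
  (λ f → f (s≤s z≤n) , Equivalence.to rec (λ {j} lt → f {suc j} (s≤s lt)))
  (λ { (ne , _) {zero} _ → ne ; (_ , wk) {suc j} (s≤s lt) → Equivalence.from rec wk lt })
  where rec = walk⇔ w (s ∘ suc) (λ {i} lt → h {suc i} (s≤s lt))

pathVertex-interior : ∀ o p {i} → i < p → pathVertex o (suc p) (suc i) ≡ 2 + (o + i)
pathVertex-interior o p {i} i<p with i ≡ᵇ p in eq
... | false = refl
... | true  = contradiction (≡ᵇ⇒≡ i p (subst T (sym eq) tt)) (<⇒≢ i<p)

pathVertex-end : ∀ o p → pathVertex o (suc p) (suc p) ≡ 1
pathVertex-end o p with p ≡ᵇ p in eq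
... | true  = refl
... | false = ⊥-elim (subst T eq (≡⇒≡ᵇ p p refl))

pathVertex-< : ∀ o p {N} → o + p ≤ N → ∀ {j} → j ≤ suc p → pathVertex o (suc p) j < 2 + N
pathVertex-< o p h {zero} _ = s≤s z≤n
pathVertex-< o p h {suc j} (s≤s j≤p) with m≤n⇒m<n∨m≡n j≤p
... | inj₁ j<p rewrite pathVertex-interior o p j<p =
  s≤s (s≤s (≤-trans (+-monoʳ-< o j<p) h))
... | inj₂ refl rewrite pathVertex-end o p = s≤s (s≤s z≤n)

PathProper : ∀ {n} → ℕ → ℕ → Vec ℕ n → Set
PathProper o l f = ∀ {j} → j < l → at f (pathVertex o l j) ≢ at f (pathVertex o l (suc j))

pathProper⇔ : ∀ o p {q} a b (v : Vec ℕ q) (w : Vec ℕ p) → (∀ {i} → i < p → at v (o + i) ≡ at w i) →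
              PathProper o (suc p) (a Vec.∷ b Vec.∷ v) ⇔ Walk a w b
pathProper⇔ o p a b v w h =
  subst (λ e → PathProper o (suc p) f ⇔ Walk a w e) (cong (at f) (pathVertex-end o p))
        (walk⇔ w (λ j → at f (pathVertex o (suc p) j))
               (λ i<p → trans (cong (at f) (pathVertex-interior o p i<p)) (h i<p)))
  where f = a Vec.∷ b Vec.∷ v

-- `PathEdge` contains each edge in both orientations, but one inequality settles both.
properOn⇔ : ∀ {n} o l (f : Vec ℕ n) → (∀ {j} → j ≤ l → pathVertex o l j < n) →
  (∀ u v → PathEdge o l (toℕ u) (toℕ v) → lookup f u ≢ lookup f v) ⇔ PathProper o l f
properOn⇔ {n} o l f bound = mk⇔ to from
  where
  to : (∀ u v → PathEdge o l (toℕ u) (toℕ v) → lookup f u ≢ lookup f v) → PathProper o l f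
  to h {j} j<l e = h u v (j , j<l , inj₁ (pu , pv))
      (trans (lookup-at f u) (trans (trans (cong (at f) pu) (trans e (cong (at f) (sym pv))))
        (sym (lookup-at f v))))
    where
    u v : Fin n
    u  = fromℕ< (bound (<⇒≤ j<l))
    v  = fromℕ< (bound j<l)
    pu = toℕ-fromℕ< (bound (<⇒≤ j<l))
    pv = toℕ-fromℕ< (bound j<l)
  from : PathProper o l f → ∀ u v → PathEdge o l (toℕ u) (toℕ v) → lookup f u ≢ lookup f v
  from h u v (j , j<l , inj₁ (p , q)) e = h j<l
    (trans (cong (at f) (sym p)) (trans (trans (sym (lookup-at f u)) (trans e (lookup-at f v)))
      (cong (at f) q)))
  from h u v (j , j<l , inj₂ (p , q)) e = h j<l
    (trans (cong (at f) (sym p)) (trans (trans (sym (lookup-at f v)) (trans (sym e) (lookup-at f u)))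
      (cong (at f) q)))

⇔-× : {X′ Y′ : Set} → X ⇔ Y → X′ ⇔ Y′ → (X × X′) ⇔ (Y × Y′)
⇔-× e e′ = mk⇔ (λ (x , x′) → Equivalence.to e x , Equivalence.to e′ x′)
               (λ (y , y′) → Equivalence.from e y , Equivalence.from e′ y′)

module _ {p₁ p₂ p₃ : ℕ} (L : ListAssignment (Θ (suc p₁) (suc p₂) (suc p₃))) where
  interior₁ : Fin p₁ → List ℕ
  interior₁ i = L (suc (suc (i ↑ˡ (p₂ + p₃))))

  interior₂ : Fin p₂ → List ℕ
  interior₂ i = L (suc (suc (p₁ ↑ʳ (i ↑ˡ p₃))))

  interior₃ : Fin p₃ → List ℕ
  interior₃ i = L (suc (suc (p₁ ↑ʳ (p₂ ↑ʳ i))))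

θ-proper⇔ : ∀ {p₁ p₂ p₃} a b (w₁ : Vec ℕ p₁) (w₂ : Vec ℕ p₂) (w₃ : Vec ℕ p₃) →
  Proper (Θ (suc p₁) (suc p₂) (suc p₃)) (a Vec.∷ b Vec.∷ (w₁ Vec.++ (w₂ Vec.++ w₃))) ⇔
  (Walk a w₁ b × Walk a w₂ b × Walk a w₃ b)
θ-proper⇔ {p₁} {p₂} {p₃} a b w₁ w₂ w₃ = mk⇔
  (λ h → Equivalence.to all₃ ((λ u v e → h u v (inj₁ e)) , (λ u v e → h u v (inj₂ (inj₁ e)))
                             , (λ u v e → h u v (inj₂ (inj₂ e)))))
  (λ ws u v → let h₁ , h₂ , h₃ = Equivalence.from all₃ ws
              in [ h₁ u v , [ h₂ u v , h₃ u v ]′ ]′)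
  where
  r = w₁ Vec.++ (w₂ Vec.++ w₃)
  infixr 9 _⨾_
  _⨾_ : {X Y Z : Set} → X ⇔ Y → Y ⇔ Z → X ⇔ Z
  e ⨾ e′ = mk⇔ (Equivalence.to e′ ∘ Equivalence.to e) (Equivalence.from e ∘ Equivalence.from e′)
  all₃ = ⇔-×
    (properOn⇔ 0 (suc p₁) (a Vec.∷ b Vec.∷ r)
       (pathVertex-< 0 p₁ (m≤m+n p₁ (p₂ + p₃)))
     ⨾ pathProper⇔ 0 p₁ a b r w₁ (at-++ˡ w₁ (w₂ Vec.++ w₃)))
    (⇔-×
      (properOn⇔ p₁ (suc p₂) (a Vec.∷ b Vec.∷ r)
         (pathVertex-< p₁ p₂ (+-monoʳ-≤ p₁ (m≤m+n p₂ p₃)))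
       ⨾ pathProper⇔ p₁ p₂ a b r w₂
           (λ i< → trans (at-++ʳ w₁ (w₂ Vec.++ w₃) _) (at-++ˡ w₂ w₃ i<)))
      (properOn⇔ (p₁ + p₂) (suc p₃) (a Vec.∷ b Vec.∷ r)
         (pathVertex-< (p₁ + p₂) p₃ (≤-reflexive (+-assoc p₁ p₂ p₃)))
       ⨾ pathProper⇔ (p₁ + p₂) p₃ a b r w₃
           (λ {i} _ → trans (cong (at r) (+-assoc p₁ p₂ i))
             (trans (at-++ʳ w₁ (w₂ Vec.++ w₃) _) (at-++ʳ w₂ w₃ i)))))

∑∑ : List ℕ → List ℕ → (ℕ → ℕ → ℕ) → ℕ
∑∑ C D f = ∑ C (λ a → ∑ D (f a))

#colourings-θ : ∀ {p₁ p₂ p₃} (L : ListAssignment (Θ (suc p₁) (suc p₂) (suc p₃))) →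
  #colourings (Θ (suc p₁) (suc p₂) (suc p₃)) L ≡
  ∑∑ (L zero) (L (suc zero)) (λ a b →
    pathColourings (interior₁ {p₁} {p₂} {p₃} L) a b *
    (pathColourings (interior₂ {p₁} {p₂} {p₃} L) a b *
     pathColourings (interior₃ {p₁} {p₂} {p₃} L) a b))
#colourings-θ {p₁} {p₂} {p₃} L = trans (length-filter-∑ (proper? G) (choices L))
  (trans (∑-cartesianProductWith Vec._∷_ (L zero) _ _)
    (∑-cong (L zero) λ a → trans (∑-cartesianProductWith Vec._∷_ (L (suc zero)) _ _)
      (∑-cong (L (suc zero)) (factor a))))
  where
  G = Θ (suc p₁) (suc p₂) (suc p₃)
  M₁ = interior₁ {p₁} {p₂} {p₃} L
  M₂ = interior₂ {p₁} {p₂} {p₃} L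
  M₃ = interior₃ {p₁} {p₂} {p₃} L
  factor : ∀ a b → ∑ (choices (λ i → L (suc (suc i)))) (λ w → ⟦ proper? G (a Vec.∷ b Vec.∷ w) ⟧) ≡
    pathColourings M₁ a b * (pathColourings M₂ a b * pathColourings M₃ a b)
  factor a b =
    trans (∑-choices-++ p₁ (p₂ + p₃) _ _)
    (trans (∑-cong (choices M₁) λ w₁ → trans (∑-choices-++ p₂ p₃ _ _)
      (trans (∑-cong (choices M₂) λ w₂ →
         trans (∑-cong (choices M₃) (split w₁ w₂))
         (trans (∑-*ˡ (choices M₃) ⟦ walk? a w₁ b ⟧ _)
           (cong (⟦ walk? a w₁ b ⟧ *_)
             (trans (∑-*ˡ (choices M₃) ⟦ walk? a w₂ b ⟧ _)
                    (cong (⟦ walk? a w₂ b ⟧ *_) (∑-walks M₃ a b))))))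
       (trans (∑-*ˡ (choices M₂) ⟦ walk? a w₁ b ⟧ _)
          (cong (⟦ walk? a w₁ b ⟧ *_)
            (trans (∑-*ʳ (choices M₂) _ _) (cong (_* pathColourings M₃ a b) (∑-walks M₂ a b)))))))
    (trans (∑-*ʳ (choices M₁) _ _) (cong (_* (pathColourings M₂ a b * pathColourings M₃ a b)) (∑-walks M₁ a b))))
    where
    split : ∀ w₁ w₂ w₃ → ⟦ proper? G (a Vec.∷ b Vec.∷ (w₁ Vec.++ (w₂ Vec.++ w₃))) ⟧ ≡
      ⟦ walk? a w₁ b ⟧ * (⟦ walk? a w₂ b ⟧ * ⟦ walk? a w₃ b ⟧)
    split w₁ w₂ w₃ =
      trans (⟦⟧-⇔ (proper? G (a Vec.∷ b Vec.∷ (w₁ Vec.++ (w₂ Vec.++ w₃)))) (walk? a w₁ b ×-dec (walk? a w₂ b ×-dec walk? a w₃ b))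
                  (θ-proper⇔ a b w₁ w₂ w₃))
      (trans (⟦⟧-× (walk? a w₁ b) (walk? a w₂ b ×-dec walk? a w₃ b)) (cong (⟦ walk? a w₁ b ⟧ *_) (⟦⟧-× (walk? a w₂ b) (walk? a w₃ b))))

-- Lists of equal length as sets of equal size.

∑-remove∉ : ∀ {L b} (g : ℕ → ℕ) → b ∉ L → ∑ L (λ c → b ≠ⁿ c * g c) ≡ ∑ L g
∑-remove∉ {L} {b} g b∉L = ∑-cong∈ L λ {c} c∈L →
  trans (cong (_* g c) (≠ⁿ-≢ {b} {c} (λ { refl → b∉L c∈L }))) (*-identityˡ (g c))

head∉tail : ∀ {x : ℕ} {xs} → Unique (x ∷ xs) → x ∉ xs
head∉tail (x≢ ∷ _) x∈ = All.lookup x≢ x∈ refl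

-- The factor `b ≠ⁿ c` deletes the term at `b`, which occurs once as `L` has no repetitions; the
-- additive form avoids truncated subtraction.
∑-remove∈ : ∀ {L b} (g : ℕ → ℕ) → Unique L → b ∈ L → ∑ L (λ c → b ≠ⁿ c * g c) + g b ≡ ∑ L g
∑-remove∈ {x ∷ xs} g u (here refl)
  rewrite ≠ⁿ-refl x | ∑-remove∉ g (head∉tail u) = +-comm (∑ xs g) (g x)
∑-remove∈ {x ∷ xs} {b} g u@(_ ∷ us) (there b∈xs)
  rewrite ≠ⁿ-≢ {b} {x} (λ { refl → head∉tail u b∈xs })
  = trans (+-assoc (1 * g x) _ (g b)) (cong₂ _+_ (*-identityˡ (g x)) (∑-remove∈ g us b∈xs))

∑-δ∉ : ∀ {L x} → x ∉ L → ∑ L (λ y → ⟦ x ≟ y ⟧) ≡ 0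
∑-δ∉ {L} {x} x∉L =
  trans (∑-cong∈ L (λ {y} y∈L → ⟦⟧-false (x ≟ y) (λ { refl → x∉L y∈L }))) (∑-zero L)

∑-δ∈ : ∀ {L x} → Unique L → x ∈ L → ∑ L (λ y → ⟦ x ≟ y ⟧) ≡ 1
∑-δ∈ {x ∷ xs} u (here refl) rewrite ⟦⟧-true (x ≟ x) refl = cong suc (∑-δ∉ (head∉tail u))
∑-δ∈ {x ∷ xs} {y} u@(_ ∷ us) (there y∈xs)
  rewrite ⟦⟧-false (y ≟ x) (λ { refl → head∉tail u y∈xs }) = ∑-δ∈ us y∈xs

∑-δ : ∀ {L} → Unique L → ∀ x → ∑ L (λ y → ⟦ x ≟ y ⟧) ≡ ⟦ x ∈? L ⟧
∑-δ {L} u x with x ∈? L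
... | yes x∈L = ∑-δ∈ u x∈L
... | no  x∉L = ∑-δ∉ x∉L

-- Both sides equal the double sum of `⟦ x ≟ y ⟧`, the size of the intersection.
∣∩∣-comm : ∀ {C L} → Unique C → Unique L → ∑ C (λ x → ⟦ x ∈? L ⟧) ≡ ∑ L (λ y → ⟦ y ∈? C ⟧)
∣∩∣-comm {C} {L} uC uL =
  trans (∑-cong C (λ x → sym (∑-δ uL x)))
  (trans (∑-comm C L _)
  (∑-cong L λ y → trans (∑-cong C (λ x → ⟦⟧-⇔ (x ≟ y) (y ≟ x) (mk⇔ sym sym))) (∑-δ uC y)))

Valid : ℕ → List ℕ → Set
Valid m L = Unique L × length L ≡ m

∑-const-valid : ∀ {m L} → Valid m L → ∀ n → ∑ L (λ _ → n) ≡ m * n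
∑-const-valid {L = L} (_ , len) n = trans (∑-const L n) (cong (_* n) len)

⟦⟧≤1 : {X : Set} (x? : Dec X) → ⟦ x? ⟧ ≤ 1
⟦⟧≤1 (yes _) = ≤-refl
⟦⟧≤1 (no _)  = z≤n

-- If `L` were contained in `C`, the intersection would have `m` elements when counted from `L`, but
-- fewer when counted from `C`, since `c` is left out.
∃∉ : ∀ {m C L c} → Valid m C → Valid m L → c ∈ C → c ∉ L → ∃ λ b → b ∈ L × b ∉ C
∃∉ {m} {C} {L} {c} vC vL c∈C c∉L with All.all? (_∈? C) L
... | no  L⊈C = find (¬All⇒Any¬ (_∈? C) L L⊈C)
... | yes L⊆C = contradiction lower (<⇒≱ upper)
  where
  lower : m ≤ ∑ C (λ x → ⟦ x ∈? L ⟧)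
  lower = ≤-reflexive (sym (trans (∣∩∣-comm (proj₁ vC) (proj₁ vL))
    (trans (∑-cong∈ L (λ y∈L → ⟦⟧-true (_ ∈? C) (All.lookup L⊆C y∈L)))
    (trans (∑-const-valid vL 1) (*-identityʳ m)))))
  upper : ∑ C (λ x → ⟦ x ∈? L ⟧) < m
  upper = begin-strict
    ∑ C (λ x → ⟦ x ∈? L ⟧)
      ≡⟨ ∑-remove∈ _ (proj₁ vC) c∈C ⟨
    ∑ C (λ x → c ≠ⁿ x * ⟦ x ∈? L ⟧) + ⟦ c ∈? L ⟧
      ≡⟨ cong (∑ C (λ x → c ≠ⁿ x * ⟦ x ∈? L ⟧) +_) (⟦⟧-false (c ∈? L) c∉L) ⟩
    ∑ C (λ x → c ≠ⁿ x * ⟦ x ∈? L ⟧) + 0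
      ≡⟨ +-identityʳ _ ⟩
    ∑ C (λ x → c ≠ⁿ x * ⟦ x ∈? L ⟧)
      ≤⟨ ∑-mono C (λ {x} _ → *-monoʳ-≤ (c ≠ⁿ x) (⟦⟧≤1 (x ∈? L))) ⟩
    ∑ C (λ x → c ≠ⁿ x * 1)
      <⟨ m<m+n _ (s≤s z≤n) ⟩
    ∑ C (λ x → c ≠ⁿ x * 1) + 1
      ≡⟨ ∑-remove∈ _ (proj₁ vC) c∈C ⟩
    ∑ C (λ _ → 1)
      ≡⟨ trans (∑-const-valid vC 1) (*-identityʳ m) ⟩
    m ∎
    where open ≤-Reasoning

infix 4 _⊆_
_⊆_ : List ℕ → List ℕ → Set
C ⊆ L = ∀ {x} → x ∈ C → x ∈ L

⊆-antisym : ∀ {m C L} → Valid m C → Valid m L → C ⊆ L → L ⊆ C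
⊆-antisym {C = C} vC vL C⊆L {x} x∈L = decidable-stable (x ∈? C) λ x∉C →
  let c , c∈C , c∉L = ∃∉ vL vC x∈L x∉C in c∉L (C⊆L c∈C)

-- Powers of the adjacency matrix of a complete graph, and rows that dominate theirs.

sel : ℕ → ℕ → ℕ → ℕ → ℕ
sel x y a b = if does (a ≟ b) then x else y

sel-≡ : ∀ x y a → sel x y a a ≡ x
sel-≡ x y a rewrite dec-true (a ≟ a) refl = refl

sel-≢ : ∀ x y {a b} → a ≢ b → sel x y a b ≡ y
sel-≢ x y {a} {b} a≢b rewrite dec-false (a ≟ b) a≢b = refl

sel-sym : ∀ x y a b → sel x y a b ≡ sel x y b a
sel-sym x y a b with a ≟ b
... | yes refl = refl
... | no  a≢b  = trans (sel-≢ x y a≢b) (sym (sel-≢ x y (a≢b ∘ sym)))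

sel-* : ∀ x y x′ y′ a b → sel x y a b * sel x′ y′ a b ≡ sel (x * x′) (y * y′) a b
sel-* x y x′ y′ a b with does (a ≟ b)
... | true  = refl
... | false = refl

-- d l and o l are the diagonal and the off-diagonal entries of the l-th power
-- of the adjacency matrix of the complete graph on k + 2 vertices.
module _ (k : ℕ) where
  mutual
    d : ℕ → ℕ
    d zero    = 1
    d (suc l) = suc k * o l

    o : ℕ → ℕ
    o zero    = 0
    o (suc l) = d l + k * o l

  K : ℕ → ℕ → ℕ → ℕ
  K l = sel (d l) (o l)

  -- The diagonal entry is allowed at any `centre` in `L`, since the colour at which a path starts
  -- need not belong to the list at its other end.
  record Dominates (l : ℕ) (L : List ℕ) (v : ℕ → ℕ) : Set where
    constructor dominates
    field
      centre   : ℕ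
      centre∈  : centre ∈ L
      centre-≤ : ∀ {b} → b ∈ L → K l centre b ≤ v b

module _ {k : ℕ} where
  private
    m : ℕ
    m = suc (suc k)

  -- The recursion gives `d (l + 1) - o (l + 1) = o l - d l`, so `d l - o l` alternates between 1
  -- and -1, reflecting the eigenvalue -1 of the adjacency matrix.
  d-even : ∀ l → parity l ≡ 0ℙ → d k l ≡ suc (o k l)
  o-odd  : ∀ l → parity l ≡ 1ℙ → o k l ≡ suc (d k l)
  d-even zero          _ = refl
  d-even (suc zero)    ()
  d-even (suc (suc l)) e rewrite d-even l e = identity k (o k l)
    where
    identity : ∀ k x → suc k * (suc x + k * x) ≡ suc (suc k * x + k * (suc x + k * x))
    identity = solve-∀
  o-odd zero          ()
  o-odd (suc zero)    _ = cong suc (trans (*-zeroʳ k) (sym (*-zeroʳ (suc k))))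
  o-odd (suc (suc l)) e rewrite o-odd l e = identity k (d k l)
    where
    identity : ∀ k x → suc k * suc x + k * (x + k * suc x) ≡ suc (suc k * (x + k * suc x))
    identity = solve-∀

  mutual
    -- Entries of a product of two matrix powers: the intermediate vertex coincides with an end or
    -- is one of the others.
    d-+ : ∀ l l′ → d k (l + l′) ≡ d k l * d k l′ + suc k * (o k l * o k l′)
    d-+ zero    l′ rewrite *-zeroʳ k = sym (trans (+-identityʳ _) (+-identityʳ _))
    d-+ (suc l) l′ rewrite o-+ l l′ = identity k (d k l) (o k l) (d k l′) (o k l′)
      where
      identity : ∀ k x y x′ y′ → suc k * (x * y′ + y * x′ + k * (y * y′)) ≡
                                 suc k * y * x′ + suc k * ((x + k * y) * y′)
      identity = solve-∀

    o-+ : ∀ l l′ → o k (l + l′) ≡ d k l * o k l′ + o k l * d k l′ + k * (o k l * o k l′)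
    o-+ zero    l′ rewrite *-zeroʳ k = sym (trans (+-identityʳ _) (trans (+-identityʳ _) (+-identityʳ _)))
    o-+ (suc l) l′ rewrite d-+ l l′ | o-+ l l′ = identity k (d k l) (o k l) (d k l′) (o k l′)
      where
      identity : ∀ k x y x′ y′ →
        x * x′ + suc k * (y * y′) + k * (x * y′ + y * x′ + k * (y * y′)) ≡
        suc k * y * y′ + (x + k * y) * x′ + k * ((x + k * y) * y′)
      identity = solve-∀

  ∑-sel : ∀ {L b x y} → Valid m L → b ∈ L → ∑ L (sel x y b) ≡ x + suc k * y
  ∑-sel {L} {b} {x} {y} vL b∈L = trans (sym (∑-remove∈ _ (proj₁ vL) b∈L))
    (trans (cong₂ _+_ off (sel-≡ x y b)) (+-comm (suc k * y) x))
    where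
    off : ∑ L (λ c → b ≠ⁿ c * sel x y b c) ≡ suc k * y
    off = trans (∑-cong L away) (+-cancelʳ-≡ y _ _
      (trans (∑-remove∈ (λ _ → y) (proj₁ vL) b∈L) (trans (∑-const-valid vL y) (+-comm y _))))
      where
      away : ∀ c → b ≠ⁿ c * sel x y b c ≡ b ≠ⁿ c * y
      away c with does (b ≟ c)
      ... | true  = refl
      ... | false = refl

  ∑-avoid-K∈ : ∀ {L a b} l → Valid m L → a ∈ L → b ∈ L →
               ∑ L (λ c → a ≠ⁿ c * K k l b c) + K k l b a ≡ d k l + suc k * o k l
  ∑-avoid-K∈ l vL a∈L b∈L = trans (∑-remove∈ _ (proj₁ vL) a∈L) (∑-sel vL b∈L)

  ∑-avoid-K∉ : ∀ {L a b} l → Valid m L → a ∉ L → b ∈ L →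
               ∑ L (λ c → a ≠ⁿ c * K k l b c) ≡ d k l + suc k * o k l
  ∑-avoid-K∉ l vL a∉L b∈L = trans (∑-remove∉ _ a∉L) (∑-sel vL b∈L)

  -- Removing the entry at `a`, which is `d l` or `o l`, from the full row sum leaves exactly the
  -- recursion for the next power.
  ∑-avoid-K : ∀ {L a b} l → Valid m L → a ∈ L → b ∈ L →
              ∑ L (λ c → a ≠ⁿ c * K k l b c) ≡ K k (suc l) a b
  ∑-avoid-K {L} {a} {b} l vL a∈L b∈L with a ≟ b
  ... | yes refl = trans (+-cancelʳ-≡ (d k l) _ _
    (trans (cong (∑ L (λ c → a ≠ⁿ c * K k l a c) +_) (sym (sel-≡ (d k l) (o k l) a)))
    (trans (∑-avoid-K∈ l vL a∈L b∈L) (+-comm (d k l) _))))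
    (sym (sel-≡ (d k (suc l)) (o k (suc l)) a))
  ... | no a≢b = trans (+-cancelʳ-≡ (o k l) _ _
    (trans (cong (∑ L (λ c → a ≠ⁿ c * K k l b c) +_) (sym (sel-≢ (d k l) (o k l) (a≢b ∘ sym))))
    (trans (∑-avoid-K∈ l vL a∈L b∈L) (identity k (d k l) (o k l)))))
    (sym (sel-≢ (d k (suc l)) (o k (suc l)) a≢b))
    where
    identity : ∀ k x y → x + suc k * y ≡ x + k * y + y
    identity = solve-∀

  K-suc≤ : ∀ l a b → K k (suc l) a b ≤ d k l + suc k * o k l
  K-suc≤ l a b with does (a ≟ b)
  ... | true  = m≤n+m _ (d k l)
  ... | false = +-monoʳ-≤ (d k l) (m≤n+m _ (o k l))

  -- If `c₀` survives in `L′`, it stays the centre. Otherwise some `b₀` of `L′` is missing from `L`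
  -- and becomes the centre: a `b` in both lists differs from `c₀` and `b₀`, so both sides are
  -- off-diagonal; a `b` outside `L` excludes nothing, and the full row sum is at least every entry
  -- of the next row.
  dominates-step : ∀ {l L L′ v} → Valid m L → Valid m L′ → Dominates k l L v →
                   Dominates k (suc l) L′ (λ b → ∑ L (λ c → b ≠ⁿ c * v c))
  dominates-step {l} {L} {L′} {v} vL vL′ (dominates c₀ c₀∈L dom) with c₀ ∈? L′
  ... | yes c₀∈L′ = dominates c₀ c₀∈L′ λ {b} _ → ≤-trans (kernel b) (lower b)
    where
    lower : ∀ b → ∑ L (λ c → b ≠ⁿ c * K k l c₀ c) ≤ ∑ L (λ c → b ≠ⁿ c * v c)
    lower b = ∑-mono L (λ {c} c∈L → *-monoʳ-≤ (b ≠ⁿ c) (dom c∈L))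
    kernel : ∀ b → K k (suc l) c₀ b ≤ ∑ L (λ c → b ≠ⁿ c * K k l c₀ c)
    kernel b with b ∈? L
    ... | yes b∈L = ≤-reflexive (trans (sel-sym (d k (suc l)) (o k (suc l)) c₀ b)
                                       (sym (∑-avoid-K l vL b∈L c₀∈L)))
    ... | no  b∉L = ≤-trans (K-suc≤ l c₀ b) (≤-reflexive (sym (∑-avoid-K∉ l vL b∉L c₀∈L)))
  ... | no c₀∉L′ with ∃∉ vL vL′ c₀∈L c₀∉L′
  ...   | b₀ , b₀∈L′ , b₀∉L = dominates b₀ b₀∈L′ λ {b} b∈L′ → ≤-trans (kernel b b∈L′) (lower b)
    where
    lower : ∀ b → ∑ L (λ c → b ≠ⁿ c * K k l c₀ c) ≤ ∑ L (λ c → b ≠ⁿ c * v c)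
    lower b = ∑-mono L (λ {c} c∈L → *-monoʳ-≤ (b ≠ⁿ c) (dom c∈L))
    kernel : ∀ b → b ∈ L′ → K k (suc l) b₀ b ≤ ∑ L (λ c → b ≠ⁿ c * K k l c₀ c)
    kernel b b∈L′ with b ∈? L
    ... | yes b∈L = ≤-reflexive (trans (sel-≢ (d k (suc l)) (o k (suc l)) {b₀} {b} (λ { refl → b₀∉L b∈L }))
                      (trans (sym (sel-≢ (d k (suc l)) (o k (suc l)) {b} {c₀} (λ { refl → c₀∉L′ b∈L′ })))
                             (sym (∑-avoid-K l vL b∈L c₀∈L))))
    ... | no  b∉L = ≤-trans (K-suc≤ l b₀ b) (≤-reflexive (sym (∑-avoid-K∉ l vL b∉L c₀∈L)))

  dominates-≗ : ∀ {l L v w} → v ≗ w → Dominates k l L v → Dominates k l L w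
  dominates-≗ e (dominates b₀ b₀∈L dom) = dominates b₀ b₀∈L λ b∈L → ≤-trans (dom b∈L) (≤-reflexive (e _))

  -- The row on `D` is carried to the start of the path edge by edge, each edge being a
  -- `dominates-step`.
  dominates-backwards : ∀ {p l D v L} (M : Fin p → List ℕ) → (∀ i → Valid m (M i)) →
    Valid m D → Valid m L → Dominates k l D v →
    Dominates k (suc p + l) L (λ c → ∑ D (λ b → pathColourings M c b * v b))
  dominates-backwards {zero}  M vM vD vL dom = dominates-step vD vL dom
  dominates-backwards {suc p} {D = D} {v} M vM vD vL dom =
    dominates-≗ rearrange
      (dominates-step (vM zero) vL (dominates-backwards (M ∘ suc) (vM ∘ suc) vD (vM zero) dom))
    where
    rearrange : ∀ a → ∑ (M zero) (λ c → a ≠ⁿ c * ∑ D (λ b → pathColourings (M ∘ suc) c b * v b)) ≡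
                      ∑ D (λ b → pathColourings M a b * v b)
    rearrange a =
      trans (∑-cong (M zero) (λ c → trans (sym (∑-*ˡ D (a ≠ⁿ c) _))
              (∑-cong D (λ b → sym (*-assoc (a ≠ⁿ c) _ (v b))))))
      (trans (∑-comm (M zero) D _)
             (∑-cong D (λ b → ∑-*ʳ (M zero) (v b) _)))

  -- Here the edges are absorbed into `v` from the start of the path, so the induction changes `v`
  -- and `l`, and the lengths have to be realigned.
  dominates-forwards : ∀ {p l C v D} (M : Fin p → List ℕ) → (∀ i → Valid m (M i)) →
    Valid m C → Valid m D → Dominates k l C v →
    Dominates k (suc p + l) D (λ b → ∑ C (λ a → v a * pathColourings M a b))
  dominates-forwards {zero} {C = C} {v} M vM vC vD dom =
    dominates-≗ (λ b → ∑-cong C (λ a → trans (cong (_* v a) (≠ⁿ-sym b a)) (*-comm (a ≠ⁿ b) (v a))))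
                (dominates-step vC vD dom)
  dominates-forwards {suc p} {l} {C} {v} {D} M vM vC vD dom =
    subst (λ n → Dominates k n D (λ b → ∑ C (λ a → v a * pathColourings M a b)))
      (+-suc (suc p) l)
      (dominates-≗ rearrange
        (dominates-forwards (M ∘ suc) (vM ∘ suc) (vM zero) vD (dominates-step vC (vM zero) dom)))
    where
    reorder : ∀ x y z → x * y * z ≡ y * (x * z)
    reorder = solve-∀
    rearrange : ∀ b → ∑ (M zero) (λ c → ∑ C (λ a → c ≠ⁿ a * v a) * pathColourings (M ∘ suc) c b) ≡
                      ∑ C (λ a → v a * pathColourings M a b)
    rearrange b =
      trans (∑-cong (M zero) (λ c → sym (∑-*ʳ C _ _)))
      (trans (∑-comm (M zero) C _)
             (∑-cong C (λ a → trans (∑-cong (M zero) (λ c →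
                trans (cong (λ e → e * v a * pathColourings (M ∘ suc) c b) (≠ⁿ-sym c a))
                      (reorder (a ≠ⁿ c) (v a) _)))
              (∑-*ˡ (M zero) (v a) _))))

  -- The walk begins with the unit row `K 0 a`, which dominates itself and selects the colour `a`
  -- from `C`.
  pathColourings-dominates : ∀ {p a C D} (M : Fin p → List ℕ) → (∀ i → Valid m (M i)) →
    Valid m C → Valid m D → a ∈ C → Dominates k (suc p) D (pathColourings M a)
  pathColourings-dominates {p} {a} {C} {D} M vM vC vD a∈C =
    subst (λ n → Dominates k n D (pathColourings M a)) (+-identityʳ (suc p))
      (dominates-≗ pick (dominates-forwards M vM vC vD
        (dominates a a∈C λ {b} _ → ≤-reflexive refl)))
    where
    pick : ∀ b → ∑ C (λ c → K k 0 a c * pathColourings M c b) ≡ pathColourings M a b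
    pick b = trans (sym (∑-remove∈ _ (proj₁ vC) a∈C))
      (cong₂ _+_
        (trans (∑-cong C λ c → away c) (∑-zero C))
        (trans (cong (_* pathColourings M a b) (sel-≡ 1 0 a)) (*-identityˡ _)))
      where
      away : ∀ c → a ≠ⁿ c * (K k 0 a c * pathColourings M c b) ≡ 0
      away c with does (a ≟ c)
      ... | true  = refl
      ... | false = refl

  -- All lists have the same size, so containing `C` means having the same colours in whatever
  -- order; each edge is then one exact matrix multiplication.
  pathColourings-exact : ∀ {p C a b} (M : Fin p → List ℕ) → Valid m C →
    (∀ i → Valid m (M i)) → (∀ i → C ⊆ M i) → a ∈ C → b ∈ C →
    pathColourings M a b ≡ K k (suc p) a b
  pathColourings-exact {zero} {a = a} {b} M vC vM C⊆M a∈C b∈C with does (a ≟ b)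
  ... | true  = sym (*-zeroʳ k)
  ... | false = cong suc (sym (*-zeroʳ k))
  pathColourings-exact {suc p} {a = a} {b} M vC vM C⊆M a∈C b∈C =
    trans (∑-cong∈ (M zero) (λ {c} c∈M → cong (a ≠ⁿ c *_)
            (trans (pathColourings-exact (M ∘ suc) vC (vM ∘ suc) (C⊆M ∘ suc)
                     (⊆-antisym vC (vM zero) (C⊆M zero) c∈M) b∈C)
                   (sel-sym (d k (suc p)) (o k (suc p)) c b))))
          (∑-avoid-K (suc p) (vM zero) (C⊆M zero a∈C) (C⊆M zero b∈C))

-- Even cycles with arbitrary lists.

module _ {k : ℕ} where
  private
    m : ℕ
    m = suc (suc k)

  o≥1 : ∀ l → 1 ≤ k → 1 ≤ o k (suc l)
  o≥1 zero    _  = s≤s z≤n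
  o≥1 (suc l) 1≤k = ≤-trans (*-mono-≤ 1≤k (o≥1 l 1≤k)) (m≤n+m _ (d k (suc l)))

  d≥ : ∀ l → 1 ≤ k → suc k ≤ d k (suc (suc l))
  d≥ l 1≤k = ≤-trans (≤-reflexive (sym (*-identityʳ (suc k)))) (*-monoʳ-≤ (suc k) (o≥1 l 1≤k))

  -- The edge closes walks of length `r` to a cycle. Of the full row sum, the row of `a` loses at
  -- most `o r`, and the row of `c₀` loses nothing as `c₀` is not in `L`. So at most `suc k * o r`
  -- is lost in all, whereas constant lists lose `m * d r`; with `o r = d r + 1` the comparison
  -- reduces to `suc k ≤ d r`.
  edge-bound : ∀ {r C L c₀} (Q : ℕ → ℕ → ℕ) → Valid m C → Valid m L →
    (∀ {a} → a ∈ C → Dominates k r L (Q a)) → o k r ≡ suc (d k r) → suc k ≤ d k r →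
    c₀ ∈ C → c₀ ∉ L →
    m * d k (suc r) ≤ ∑∑ C L (λ a c → a ≠ⁿ c * Q a c)
  edge-bound {r} {C} {L} {c₀} Q vC vL dom o≡ d≥k c₀∈C c₀∉L =
    +-cancelʳ-≤ (suc k * o k r) _ _ (begin
      m * d k (suc r) + suc k * o k r
        ≤⟨ arithmetic ⟩
      m * (d k r + suc k * o k r)
        ≡⟨ ∑-const-valid vC _ ⟨
      ∑ C (λ _ → d k r + suc k * o k r)
        ≤⟨ ∑-mono C row ⟩
      ∑ C (λ a → ∑ L (λ c → a ≠ⁿ c * Q a c) + c₀ ≠ⁿ a * o k r)
        ≡⟨ ∑-+ C _ _ ⟩
      ∑∑ C L (λ a c → a ≠ⁿ c * Q a c) + ∑ C (λ a → c₀ ≠ⁿ a * o k r)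
        ≡⟨ cong (∑∑ C L (λ a c → a ≠ⁿ c * Q a c) +_) others ⟩
      ∑∑ C L (λ a c → a ≠ⁿ c * Q a c) + suc k * o k r ∎)
    where
    open ≤-Reasoning
    others : ∑ C (λ a → c₀ ≠ⁿ a * o k r) ≡ suc k * o k r
    others = +-cancelʳ-≡ (o k r) _ _ (trans (∑-remove∈ (λ _ → o k r) (proj₁ vC) c₀∈C)
      (trans (∑-const-valid vC (o k r)) (+-comm (o k r) _)))
    arithmetic : m * d k (suc r) + suc k * o k r ≤ m * (d k r + suc k * o k r)
    arithmetic rewrite o≡ = begin
      m * (suc k * suc (d k r)) + suc k * suc (d k r)
        ≡⟨ left k (d k r) ⟩
      suc k + (suc k * d k r + m * (suc k * suc (d k r)))
        ≤⟨ +-monoˡ-≤ _ d≥k ⟩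
      d k r + (suc k * d k r + m * (suc k * suc (d k r)))
        ≡⟨ right k (d k r) ⟩
      m * (d k r + suc k * suc (d k r)) ∎
      where
      left : ∀ k x → suc (suc k) * (suc k * suc x) + suc k * suc x ≡
                     suc k + (suc k * x + suc (suc k) * (suc k * suc x))
      left = solve-∀
      right : ∀ k x → x + (suc k * x + suc (suc k) * (suc k * suc x)) ≡
                      suc (suc k) * (x + suc k * suc x)
      right = solve-∀
    K≤o : ∀ a b → K k r a b ≤ o k r
    K≤o a b with does (a ≟ b)
    ... | true  = ≤-trans (n≤1+n _) (≤-reflexive (sym o≡))
    ... | false = ≤-refl
    row : ∀ {a} → a ∈ C → d k r + suc k * o k r ≤ ∑ L (λ c → a ≠ⁿ c * Q a c) + c₀ ≠ⁿ a * o k r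
    row {a} a∈C with dom a∈C
    ... | dominates b₀ b₀∈L dom-a = bound (a ∈? L)
      where
      lower : ∑ L (λ c → a ≠ⁿ c * K k r b₀ c) ≤ ∑ L (λ c → a ≠ⁿ c * Q a c)
      lower = ∑-mono L (λ {c} c∈L → *-monoʳ-≤ (a ≠ⁿ c) (dom-a c∈L))
      bound : Dec (a ∈ L) → d k r + suc k * o k r ≤ ∑ L (λ c → a ≠ⁿ c * Q a c) + c₀ ≠ⁿ a * o k r
      bound (no a∉L) = ≤-trans (≤-reflexive (sym (∑-avoid-K∉ r vL a∉L b₀∈L)))
        (≤-trans lower (m≤m+n _ _))
      bound (yes a∈L) rewrite ≠ⁿ-≢ {c₀} {a} (λ { refl → c₀∉L a∈L }) | +-identityʳ (o k r) =
        ≤-trans (≤-reflexive (sym (∑-avoid-K∈ r vL a∈L b₀∈L))) (+-mono-≤ lower (K≤o b₀ a))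

  -- If no edge of the first path joins vertices with different lists, its edges
  -- are moved one by one to the second path; otherwise edge-bound applies to the
  -- first edge that does.
  cycle-or-constant : ∀ {p q C D} (M : Fin p → List ℕ) (N : Fin q → List ℕ) →
    (∀ i → Valid m (M i)) → (∀ i → Valid m (N i)) → Valid m C → Valid m D →
    o k (p + suc q) ≡ suc (d k (p + suc q)) → suc k ≤ d k (p + suc q) →
    (m * d k (suc p + suc q) ≤ ∑∑ C D (λ a b → pathColourings M a b * pathColourings N a b)) ⊎
    ((∀ i → C ⊆ M i) × C ⊆ D)
  cycle-or-constant {zero} {q} {C} {D} M N vM vN vC vD o≡ d≥k with All.all? (_∈? D) C
  ... | yes C⊆D = inj₂ ((λ ()) , All.lookup C⊆D)
  ... | no  C⊈D =
    let c₀ , c₀∈C , c₀∉D = find (¬All⇒Any¬ (_∈? D) C C⊈D)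
    in inj₁ (edge-bound (pathColourings N) vC vD
               (pathColourings-dominates N vN vC vD) o≡ d≥k c₀∈C c₀∉D)
  cycle-or-constant {suc p} {q} {C} {D} M N vM vN vC vD o≡ d≥k with All.all? (_∈? M zero) C
  ... | no  C⊈M =
    let c₀ , c₀∈C , c₀∉M = find (¬All⇒Any¬ (_∈? M zero) C C⊈M)
    in inj₁ (≤-trans
         (edge-bound Q vC (vM zero)
           (λ a∈C → dominates-backwards (M ∘ suc) (vM ∘ suc) vD (vM zero)
                      (pathColourings-dominates N vN vC vD a∈C))
           o≡ d≥k c₀∈C c₀∉M)
         (≤-reflexive (∑-cong C rearrange)))
    where
    Q : ℕ → ℕ → ℕ
    Q a c = ∑ D (λ b → pathColourings (M ∘ suc) c b * pathColourings N a b)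
    rearrange : ∀ a → ∑ (M zero) (λ c → a ≠ⁿ c * Q a c) ≡
                      ∑ D (λ b → pathColourings M a b * pathColourings N a b)
    rearrange a =
      trans (∑-cong (M zero) (λ c → trans (sym (∑-*ˡ D (a ≠ⁿ c) _))
              (∑-cong D (λ b → sym (*-assoc (a ≠ⁿ c) _ _)))))
      (trans (∑-comm (M zero) D _) (∑-cong D (λ b → ∑-*ʳ (M zero) _ _)))
  ... | yes C⊆M =
    [ (λ h → inj₁ (≤-trans (≤-reflexive (cong (λ n → m * d k (suc n)) (sym (+-suc p (suc q)))))
                     (≤-trans h (≤-reflexive rotate))))
    , (λ (M₀⊆M , M₀⊆D) → inj₂ ( (λ { zero → All.lookup C⊆M ; (suc i) {x} x∈C → M₀⊆M i (All.lookup C⊆M x∈C) })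
                              , λ {x} x∈C → M₀⊆D (All.lookup C⊆M x∈C)))
    -- The first inner vertex becomes an end, and the old end with list `C` becomes the first inner
    -- vertex of the second path; the cycle stays the same.
    ]′ (cycle-or-constant (M ∘ suc) (C ◂ N) (vM ∘ suc) (λ { zero → vC ; (suc i) → vN i })
          (vM zero) vD
          (subst (λ n → o k n ≡ suc (d k n)) (sym (+-suc p (suc q))) o≡)
          (subst (λ n → suc k ≤ d k n) (sym (+-suc p (suc q))) d≥k))
    where
    reorder : ∀ x y z → x * (y * z) ≡ y * x * z
    reorder = solve-∀
    rotate : ∑∑ (M zero) D (λ c b → pathColourings (M ∘ suc) c b * pathColourings (C ◂ N) c b) ≡
             ∑∑ C D (λ a b → pathColourings M a b * pathColourings N a b)
    rotate =
      trans (∑-comm (M zero) D _)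
      (trans (∑-cong D (λ b →
        trans (∑-cong (M zero) (λ c → trans (sym (∑-*ˡ C (pathColourings (M ∘ suc) c b) _))
          (∑-cong C (λ a → trans (reorder _ (c ≠ⁿ a) _)
             (cong (λ e → e * pathColourings (M ∘ suc) c b * pathColourings N a b) (≠ⁿ-sym c a))))))
        (trans (∑-comm (M zero) C _) (∑-cong C (λ a → ∑-*ʳ (M zero) _ _)))))
      (∑-comm D C _))

  ∑∑-sel : ∀ {C D} x y → Valid m C → Valid m D → C ⊆ D → ∑∑ C D (sel x y) ≡ m * (x + suc k * y)
  ∑∑-sel {C} x y vC vD C⊆D = trans (∑-cong∈ C (λ a∈C → ∑-sel vD (C⊆D a∈C))) (∑-const-valid vC _)

  -- m * d k l is the number of proper m-colourings of a cycle of length l.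
  even-cycle-bound : ∀ {p q C D} (M : Fin p → List ℕ) (N : Fin q → List ℕ) →
    (∀ i → Valid m (M i)) → (∀ i → Valid m (N i)) → Valid m C → Valid m D →
    o k (p + suc q) ≡ suc (d k (p + suc q)) → suc k ≤ d k (p + suc q) →
    m * d k (suc p + suc q) ≤ ∑∑ C D (λ a b → pathColourings M a b * pathColourings N a b)
  even-cycle-bound {p} {q} {C} {D} M N vM vN vC vD o≡ d≥k
    -- If the first path turns out constant, the second is searched in the same way; if both are
    -- constant, the count is exact.
    with cycle-or-constant M N vM vN vC vD o≡ d≥k
       | cycle-or-constant N M vN vM vC vD
           (subst (λ n → o k n ≡ suc (d k n)) length-comm o≡) (subst (λ n → suc k ≤ d k n) length-comm d≥k)
    where
    length-comm : p + suc q ≡ q + suc p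
    length-comm = trans (+-suc p q) (trans (cong suc (+-comm p q)) (sym (+-suc q p)))
  ... | inj₁ h | _ = h
  ... | inj₂ _ | inj₁ h = ≤-trans (≤-reflexive (cong (λ n → m * d k n) (+-comm (suc p) (suc q))))
    (≤-trans h (≤-reflexive (∑-cong C (λ a → ∑-cong D (λ b → *-comm (pathColourings N a b) _)))))
  ... | inj₂ (C⊆M , C⊆D) | inj₂ (C⊆N , _) = ≤-reflexive (sym
    (trans (∑-cong∈ C (λ {a} a∈C → ∑-cong∈ D (λ {b} b∈D →
        let b∈C = ⊆-antisym vC vD C⊆D b∈D in
        trans (cong₂ _*_ (pathColourings-exact M vC vM C⊆M a∈C b∈C)
                         (pathColourings-exact N vC vN C⊆N a∈C b∈C))
              (sel-* (d k (suc p)) (o k (suc p)) (d k (suc q)) (o k (suc q)) a b))))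
    (trans (∑∑-sel _ _ vC vD C⊆D) (cong (m *_) (sym (d-+ (suc p) (suc q)))))))

  -- Adding a third path of the other parity to an even cycle.

  module _ {C D : List ℕ} (vC : Valid m C) (vD : Valid m D) {W V : ℕ → ℕ → ℕ} {l x y : ℕ}
           (dom : ∀ {a} → a ∈ C → Dominates k l D (V a))
           (total : m * (x + suc k * y) ≤ ∑∑ C D W) where

    private
      -- The bound `total` concerns the whole sum, not single rows. Hence `n`, the smaller entry of
      -- `K l`, is factored out of all rows at once, and `z` is what the larger entries add to each
      -- row.
      combine : ∀ {n} z → (∀ {a} → a ∈ C → n * ∑ D (W a) + z ≤ ∑ D (λ b → W a b * V a b)) →
                m * (n * (x + suc k * y) + z) ≤ ∑∑ C D (λ a b → W a b * V a b)
      combine {n} z row = begin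
        m * (n * (x + suc k * y) + z)
          ≡⟨ distribute m n (x + suc k * y) z ⟩
        n * (m * (x + suc k * y)) + m * z
          ≤⟨ +-monoˡ-≤ (m * z) (*-monoʳ-≤ n total) ⟩
        n * ∑∑ C D W + m * z
          ≡⟨ cong₂ _+_ (sym (∑-*ˡ C n _)) (sym (∑-const-valid vC z)) ⟩
        ∑ C (λ a → n * ∑ D (W a)) + ∑ C (λ _ → z)
          ≡⟨ ∑-+ C _ _ ⟨
        ∑ C (λ a → n * ∑ D (W a) + z)
          ≤⟨ ∑-mono C row ⟩
        ∑∑ C D (λ a b → W a b * V a b) ∎
        where
        open ≤-Reasoning
        distribute : ∀ m n e z → m * (n * e + z) ≡ n * (m * e) + m * z
        distribute = solve-∀

    -- `V` is at least `o l` everywhere and one more at the centre of each row, where `W` is at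
    -- least `x`, wherever the centre lies.
    add-even-path : d k l ≡ suc (o k l) → (∀ {a b} → a ∈ C → b ∈ D → x ≤ W a b) →
      m * (x * d k l + suc k * (y * o k l)) ≤ ∑∑ C D (λ a b → W a b * V a b)
    add-even-path d≡ x≤W = ≤-trans (≤-reflexive (cong (m *_) identity)) (combine {o k l} x row)
      where
      identity : x * d k l + suc k * (y * o k l) ≡ o k l * (x + suc k * y) + x
      identity rewrite d≡ = rearrange k x y (o k l)
        where
        rearrange : ∀ k x y n → x * suc n + suc k * (y * n) ≡ n * (x + suc k * y) + x
        rearrange = solve-∀
      row : ∀ {a} → a ∈ C → o k l * ∑ D (W a) + x ≤ ∑ D (λ b → W a b * V a b)
      row {a} a∈C with dom a∈C
      ... | dominates b₀ b₀∈D dom-a = begin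
        o k l * ∑ D (W a) + x
          ≡⟨ cong₂ _+_ (sym (∑-*ˡ D (o k l) (W a)))
               (trans (sym (trans (cong (x +_) (*-zeroʳ (suc k))) (+-identityʳ x))) (sym (∑-sel {k} {D} {b₀} {x} {0} vD b₀∈D))) ⟩
        ∑ D (λ b → o k l * W a b) + ∑ D (sel x 0 b₀)
          ≡⟨ ∑-+ D _ _ ⟨
        ∑ D (λ b → o k l * W a b + sel x 0 b₀ b)
          ≤⟨ ∑-mono D (λ {b} b∈D → ≤-trans (entry b b∈D) (*-monoʳ-≤ (W a b) (dom-a b∈D))) ⟩
        ∑ D (λ b → W a b * V a b) ∎
        where
        open ≤-Reasoning
        entry : ∀ b → b ∈ D → o k l * W a b + sel x 0 b₀ b ≤ W a b * K k l b₀ b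
        entry b b∈D with does (b₀ ≟ b)
        ... | false = ≤-reflexive (trans (+-identityʳ _) (*-comm (o k l) (W a b)))
        ... | true rewrite d≡ | *-suc (W a b) (o k l) | *-comm (o k l) (W a b) =
          ≤-trans (+-monoʳ-≤ (W a b * o k l) (x≤W a∈C b∈D)) (≤-reflexive (+-comm _ (W a b)))

    -- Now the extra 1 sits at the `k + 1` places off the centre, each worth at least `y`.
    add-odd-path : o k l ≡ suc (d k l) → (∀ {a b} → a ∈ C → b ∈ D → y ≤ W a b) →
      m * (x * d k l + suc k * (y * o k l)) ≤ ∑∑ C D (λ a b → W a b * V a b)
    add-odd-path o≡ y≤W = ≤-trans (≤-reflexive (cong (m *_) identity)) (combine {d k l} (suc k * y) row)
      where
      identity : x * d k l + suc k * (y * o k l) ≡ d k l * (x + suc k * y) + suc k * y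
      identity rewrite o≡ = rearrange k x y (d k l)
        where
        rearrange : ∀ k x y n → x * n + suc k * (y * suc n) ≡ n * (x + suc k * y) + suc k * y
        rearrange = solve-∀
      row : ∀ {a} → a ∈ C → d k l * ∑ D (W a) + suc k * y ≤ ∑ D (λ b → W a b * V a b)
      row {a} a∈C with dom a∈C
      ... | dominates b₀ b₀∈D dom-a = begin
        d k l * ∑ D (W a) + suc k * y
          ≡⟨ cong₂ _+_ (sym (∑-*ˡ D (d k l) (W a))) (sym (∑-sel {k} {D} {b₀} {0} {y} vD b₀∈D)) ⟩
        ∑ D (λ b → d k l * W a b) + ∑ D (sel 0 y b₀)
          ≡⟨ ∑-+ D _ _ ⟨
        ∑ D (λ b → d k l * W a b + sel 0 y b₀ b)
          ≤⟨ ∑-mono D (λ {b} b∈D → ≤-trans (entry b b∈D) (*-monoʳ-≤ (W a b) (dom-a b∈D))) ⟩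
        ∑ D (λ b → W a b * V a b) ∎
        where
        open ≤-Reasoning
        entry : ∀ b → b ∈ D → d k l * W a b + sel 0 y b₀ b ≤ W a b * K k l b₀ b
        entry b b∈D with does (b₀ ≟ b)
        ... | true  = ≤-reflexive (trans (+-identityʳ _) (*-comm (d k l) (W a b)))
        ... | false rewrite o≡ | *-suc (W a b) (d k l) | *-comm (d k l) (W a b) =
          ≤-trans (+-monoʳ-≤ (W a b * d k l) (y≤W a∈C b∈D)) (≤-reflexive (+-comm _ (W a b)))

parity-+-same : ∀ l l′ → parity l ≡ parity l′ → parity (l + l′) ≡ 0ℙ
parity-+-same l l′ e rewrite +-homo-+ l l′ | e = p+p≡0ℙ (parity l′)

parity-pred : ∀ l → parity (suc l) ≡ 0ℙ → parity l ≡ 1ℙ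
parity-pred l e = trans (sym (suc-homo-⁻¹ l)) (cong _⁻¹ e)

module _ {k : ℕ} (1≤k : 1 ≤ k) {p q r : ℕ} {C D : List ℕ}
         (M : Fin p → List ℕ) (N : Fin q → List ℕ) (R : Fin r → List ℕ) where
  private
    m : ℕ
    m = suc (suc k)

  theta-bound : (∀ i → Valid m (M i)) → (∀ i → Valid m (N i)) → (∀ i → Valid m (R i)) →
    Valid m C → Valid m D → 1 ≤ p + q →
    parity (suc p) ≡ parity (suc q) → parity (suc p) ≢ parity (suc r) →
    m * (d k (suc p) * d k (suc q) * d k (suc r) + suc k * (o k (suc p) * o k (suc q) * o k (suc r)))
      ≤ ∑∑ C D (λ a b → pathColourings M a b * pathColourings N a b * pathColourings R a b)
  theta-bound vM vN vR vC vD 1≤p+q pq pr = by-parity (parity (suc p)) refl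
    where
    W : ℕ → ℕ → ℕ
    W a b = pathColourings M a b * pathColourings N a b
    -- The cycle has `s + 1` edges, and `s` of them remain when `edge-bound` singles one out;
    -- `1 ≤ p + q` makes `s` at least 2.
    s = p + suc q
    s≡ : ∃ λ n → s ≡ suc (suc n)
    s≡ = p + q ∸ 1 , trans (+-suc p q) (cong suc (sym (m+[n∸m]≡n 1≤p+q)))
    odd-s : parity s ≡ 1ℙ
    odd-s = parity-pred s (parity-+-same (suc p) (suc q) pq)
    d≥k : suc k ≤ d k s
    d≥k rewrite proj₂ s≡ = d≥ (proj₁ s≡) 1≤k
    total : m * (d k (suc p) * d k (suc q) + suc k * (o k (suc p) * o k (suc q))) ≤ ∑∑ C D W
    total = ≤-trans (≤-reflexive (cong (m *_) (sym (d-+ (suc p) (suc q)))))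
      (even-cycle-bound M N vM vN vC vD (o-odd s odd-s) d≥k)
    domM : ∀ {a} → a ∈ C → Dominates k (suc p) D (pathColourings M a)
    domM = pathColourings-dominates M vM vC vD
    domN : ∀ {a} → a ∈ C → Dominates k (suc q) D (pathColourings N a)
    domN = pathColourings-dominates N vN vC vD
    domR : ∀ {a} → a ∈ C → Dominates k (suc r) D (pathColourings R a)
    domR = pathColourings-dominates R vR vC vD
    d≤K : ∀ l → parity l ≡ 1ℙ → ∀ a b → d k l ≤ K k l a b
    d≤K l e a b with does (a ≟ b)
    ... | true  = ≤-refl
    ... | false = ≤-trans (n≤1+n _) (≤-reflexive (sym (o-odd l e)))
    o≤K : ∀ l → parity l ≡ 0ℙ → ∀ a b → o k l ≤ K k l a b
    o≤K l e a b with does (a ≟ b)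
    ... | true  = ≤-trans (n≤1+n _) (≤-reflexive (sym (d-even l e)))
    ... | false = ≤-refl
    minimum : ∀ {l v z} → Dominates k l D v → (∀ a b → z ≤ K k l a b) → ∀ {b} → b ∈ D → z ≤ v b
    minimum (dominates b₀ _ dom) z≤K {b} b∈D = ≤-trans (z≤K b₀ b) (dom b∈D)
    by-parity : ∀ e → parity (suc p) ≡ e →
      m * (d k (suc p) * d k (suc q) * d k (suc r) + suc k * (o k (suc p) * o k (suc q) * o k (suc r)))
        ≤ ∑∑ C D (λ a b → W a b * pathColourings R a b)
    -- Even paths have their smaller entry off the diagonal, which is where the odd third path has
    -- its larger one. The other case exchanges the two places.
    by-parity 0ℙ e = add-odd-path {k} vC vD {W} {pathColourings R} {suc r} {d k (suc p) * d k (suc q)} {o k (suc p) * o k (suc q)} domR total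
      (o-odd (suc r) (r-odd (parity (suc r)) refl))
      λ a∈C b∈D → *-mono-≤ (minimum (domM a∈C) (o≤K (suc p) e) b∈D)
                           (minimum (domN a∈C) (o≤K (suc q) (trans (sym pq) e)) b∈D)
      where
      r-odd : ∀ f → parity (suc r) ≡ f → parity (suc r) ≡ 1ℙ
      r-odd 0ℙ f = contradiction (trans e (sym f)) pr
      r-odd 1ℙ f = f
    by-parity 1ℙ e = add-even-path {k} vC vD {W} {pathColourings R} {suc r} {d k (suc p) * d k (suc q)} {o k (suc p) * o k (suc q)} domR total
      (d-even (suc r) (r-even (parity (suc r)) refl))
      λ a∈C b∈D → *-mono-≤ (minimum (domM a∈C) (d≤K (suc p) e) b∈D)
                           (minimum (domN a∈C) (d≤K (suc q) (trans (sym pq) e)) b∈D)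
      where
      r-even : ∀ f → parity (suc r) ≡ f → parity (suc r) ≡ 0ℙ
      r-even 0ℙ f = f
      r-even 1ℙ f = contradiction (trans e (sym f)) pr

-- Θ(2, 2, 2) with at least three colours.

avoids : List ℕ → ℕ → ℕ
avoids L x = ⟦ ¬? (x ∈? L) ⟧

∈+avoids : ∀ L x → ⟦ x ∈? L ⟧ + avoids L x ≡ 1
∈+avoids L x with does (x ∈? L)
... | true  = refl
... | false = refl

∑-avoids : ∀ {m L} → Valid m L → ∀ C → ∑ L (λ x → ⟦ x ∈? C ⟧) + ∑ L (avoids C) ≡ m
∑-avoids {m} {L} vL C = trans (sym (∑-+ L _ _)) (trans (∑-cong L (∈+avoids C))
  (trans (∑-const-valid vL 1) (*-identityʳ m)))

avoids-comm : ∀ {m C L} → Valid m C → Valid m L → ∑ C (avoids L) ≡ ∑ L (avoids C)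
avoids-comm {C = C} {L} vC vL = +-cancelˡ-≡ (∑ C (λ x → ⟦ x ∈? L ⟧)) _ _
  (trans (∑-avoids vC L)
  (trans (sym (∑-avoids vL C))
         (cong (_+ ∑ L (avoids C)) (∣∩∣-comm (proj₁ vL) (proj₁ vC)))))

∑-≠ : ∀ {n L} → Valid (suc (suc n)) L → ∀ b → ∑ L (λ c → b ≠ⁿ c * 1) ≡ suc n + avoids L b
∑-≠ {n} {L} vL b with b ∈? L
... | yes b∈L = trans (+-cancelʳ-≡ 1 _ (suc n) (trans (∑-remove∈ (λ _ → 1) (proj₁ vL) b∈L)
                  (trans (∑-const-valid vL 1) (trans (*-identityʳ _) (+-comm 1 (suc n))))))
                  (sym (+-identityʳ (suc n)))
... | no  b∉L = trans (∑-remove∉ (λ _ → 1) b∉L)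
                  (trans (∑-const-valid vL 1) (trans (*-identityʳ _) (+-comm 1 (suc n))))

-- Agrees definitionally with `pathColourings` for a single inner vertex.
middle : List ℕ → ℕ → ℕ → ℕ
middle L a b = ∑ L (λ c → a ≠ⁿ c * c ≠ⁿ b)

-- Each end colour costs one of the `n + 2` colours of the middle vertex, and `avoids` gives it back
-- if it was absent from `L`.
middle-formula : ∀ {n L} → Valid (suc (suc n)) L → ∀ a b →
  middle L a b ≡ sel (suc n + avoids L a) (n + avoids L a + avoids L b) a b
middle-formula {n} {L} vL a b with a ≟ b
... | yes refl = trans (∑-cong L same) (trans (∑-≠ vL a)
                   (sym (sel-≡ (suc n + avoids L a) (n + avoids L a + avoids L a) a)))
  where
  same : ∀ c → a ≠ⁿ c * c ≠ⁿ a ≡ a ≠ⁿ c * 1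
  same c rewrite ≠ⁿ-sym c a with does (a ≟ c)
  ... | true  = refl
  ... | false = refl
... | no a≢b = trans distinct (sym (sel-≢ (suc n + avoids L a) (n + avoids L a + avoids L b) a≢b))
  where
  total : ∑ L (λ c → c ≠ⁿ b) ≡ suc n + avoids L b
  total = trans (∑-cong L (λ c → trans (≠ⁿ-sym c b) (sym (*-identityʳ (b ≠ⁿ c))))) (∑-≠ vL b)
  distinct : middle L a b ≡ n + avoids L a + avoids L b
  distinct with a ∈? L
  ... | yes a∈L = +-cancelʳ-≡ 1 _ _ (trans (cong (middle L a b +_) (sym (≠ⁿ-≢ {a} {b} a≢b)))
                    (trans (∑-remove∈ (_≠ⁿ b) (proj₁ vL) a∈L) (trans total (rearrange n (avoids L b)))))
    where
    rearrange : ∀ n x → suc n + x ≡ n + 0 + x + 1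
    rearrange = solve-∀
  ... | no  a∉L = trans (∑-remove∉ (_≠ⁿ b) a∉L) (trans total (cong (_+ avoids L b) (+-comm 1 n)))

-- |(C ∪ D) ∖ L| ≥ |D ∖ C|
∑-missing : ∀ {m C D L} → Valid m C → Valid m D → Valid m L →
  ∑ D (avoids C) ≤ ∑ C (avoids L) + ∑ D (λ y → avoids L y * avoids C y)
∑-missing {m} {C} {D} {L} vC vD vL = begin
  ∑ D (avoids C)
    ≡⟨ ∑-cong D (λ y → sym (trans (sym (*-distribʳ-+ (avoids C y) ⟦ y ∈? L ⟧ _))
         (trans (cong (_* avoids C y) (∈+avoids L y)) (*-identityˡ _)))) ⟩
  ∑ D (λ y → ⟦ y ∈? L ⟧ * avoids C y + avoids L y * avoids C y)
    ≡⟨ ∑-+ D _ _ ⟩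
  ∑ D (λ y → ⟦ y ∈? L ⟧ * avoids C y) + rest
    ≤⟨ +-monoˡ-≤ rest hit ⟩
  ∑ C (avoids L) + rest ∎
  where
  open ≤-Reasoning
  rest = ∑ D (λ y → avoids L y * avoids C y)
  δ-subst : ∀ x y → ⟦ y ≟ x ⟧ * avoids C y ≡ ⟦ x ≟ y ⟧ * avoids C x
  δ-subst x y with x ≟ y
  ... | yes refl = refl
  ... | no  x≢y  = trans (cong (_* avoids C y) (⟦⟧-false (y ≟ x) (x≢y ∘ sym)))
                     (sym (cong (_* avoids C x) (⟦⟧-false (x ≟ y) x≢y)))
  -- The colours of `D` outside `C` that lie in `L` are among those of `L` outside `C`, and these
  -- are as many as the colours of `C` outside `L`.
  hit : ∑ D (λ y → ⟦ y ∈? L ⟧ * avoids C y) ≤ ∑ C (avoids L)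
  hit = begin
    ∑ D (λ y → ⟦ y ∈? L ⟧ * avoids C y)
      ≡⟨ ∑-cong D (λ y → trans (cong (_* avoids C y) (sym (∑-δ (proj₁ vL) y))) (sym (∑-*ʳ L _ _))) ⟩
    ∑ D (λ y → ∑ L (λ x → ⟦ y ≟ x ⟧ * avoids C y))
      ≡⟨ ∑-comm D L _ ⟩
    ∑ L (λ x → ∑ D (λ y → ⟦ y ≟ x ⟧ * avoids C y))
      ≡⟨ ∑-cong L (λ x → trans (∑-cong D (δ-subst x)) (trans (∑-*ʳ D _ _)
           (cong (_* avoids C x) (∑-δ (proj₁ vD) x)))) ⟩
    ∑ L (λ x → ⟦ x ∈? D ⟧ * avoids C x)
      ≤⟨ ∑-mono L (λ {x} _ → ≤-trans (*-monoˡ-≤ (avoids C x) (⟦⟧≤1 (x ∈? D)))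
                                     (≤-reflexive (*-identityˡ _))) ⟩
    ∑ L (avoids C)
      ≡⟨ avoids-comm vC vL ⟨
    ∑ C (avoids L) ∎

cube : ℕ → ℕ
cube n = n * n * n

-- (n + 1)³ − n³
gap : ℕ → ℕ
gap n = 3 * (n * n) + 3 * n + 1

module _ {j : ℕ} {C D L₁ L₂ L₃ : List ℕ} where
  private
    n m : ℕ
    n = suc j
    m = suc (suc n)

    -- The surplus of the middle lists, credited to the two ends. The factor `avoids C b` makes `β`
    -- vanish on the diagonal, where `α` already accounts for it.
    α β : ℕ → ℕ
    α a = avoids L₁ a + avoids L₂ a + avoids L₃ a
    β b = avoids L₁ b * avoids C b + avoids L₂ b * avoids C b + avoids L₃ b * avoids C b

  -- Split `m` as `s + g`, where `g` colours of `D` are not in `C`. Compared with constant lists,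
  -- `g` diagonal pairs, worth `gap n` each, are lost. Each unit of `α` or `β` gains at least
  -- `n * n` in each of `m` pairs, and `∑-missing` provides at least `3 * g` units.
  K₂₃-bound-≥3 : Valid m C → Valid m D → Valid m L₁ → Valid m L₂ → Valid m L₃ →
    m * (cube (suc n) + suc n * cube n) ≤
    ∑∑ C D (λ a b → middle L₁ a b * middle L₂ a b * middle L₃ a b)
  K₂₃-bound-≥3 vC vD v₁ v₂ v₃ = begin
    m * (cube (suc n) + suc n * cube n)
      ≡⟨ expected n ⟩
    m * (m * cube n) + gap n * m
      ≡⟨ cong (λ e → m * (m * cube n) + gap n * e) (∑-avoids vD C) ⟨
    m * (m * cube n) + gap n * (s + g)
      ≤⟨ +-monoʳ-≤ (m * (m * cube n)) compensate ⟩
    m * (m * cube n) + (gap n * s + n * n * (m * (∑ C α + ∑ D β)))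
      ≡⟨ cong (λ e → m * (m * cube n) + (gap n * e + n * n * (m * (∑ C α + ∑ D β)))) common ⟨
    m * (m * cube n) + (gap n * ∑ C (λ a → ⟦ a ∈? D ⟧) + n * n * (m * (∑ C α + ∑ D β)))
      ≡⟨ regroup (m * (m * cube n)) (gap n * ∑ C (λ a → ⟦ a ∈? D ⟧)) (n * n) m (∑ C α) (∑ D β) ⟩
    m * (m * cube n) + gap n * ∑ C (λ a → ⟦ a ∈? D ⟧) + n * n * (m * ∑ C α) + m * (n * n * ∑ D β)
      ≡⟨ sums ⟨
    ∑∑ C D (λ a b → cube n + gap n * ⟦ a ≟ b ⟧ + n * n * α a + n * n * β b)
      ≤⟨ ∑-mono C (λ {a} a∈C → ∑-mono D (λ {b} _ → pointwise a b a∈C)) ⟩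
    ∑∑ C D (λ a b → middle L₁ a b * middle L₂ a b * middle L₃ a b) ∎
    where
    open ≤-Reasoning
    s = ∑ D (λ b → ⟦ b ∈? C ⟧)
    g = ∑ D (avoids C)
    common : ∑ C (λ a → ⟦ a ∈? D ⟧) ≡ s
    common = ∣∩∣-comm (proj₁ vC) (proj₁ vD)
    expected : ∀ n → suc (suc n) * (suc n * suc n * suc n + suc n * (n * n * n)) ≡
      suc (suc n) * (suc (suc n) * (n * n * n)) + (3 * (n * n) + 3 * n + 1) * suc (suc n)
    expected = solve-∀
    regroup : ∀ x y z m a b → x + (y + z * (m * (a + b))) ≡ x + y + z * (m * a) + m * (z * b)
    regroup = solve-∀
    sums : ∑∑ C D (λ a b → cube n + gap n * ⟦ a ≟ b ⟧ + n * n * α a + n * n * β b) ≡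
      m * (m * cube n) + gap n * ∑ C (λ a → ⟦ a ∈? D ⟧) + n * n * (m * ∑ C α) + m * (n * n * ∑ D β)
    sums = trans (∑-cong C row)
      (trans (∑-+ C _ _) (cong₂ _+_
        (trans (∑-+ C _ _) (cong₂ _+_
          (trans (∑-+ C _ _) (cong₂ _+_ (∑-const-valid vC (m * cube n)) (∑-*ˡ C (gap n) (λ a → ⟦ a ∈? D ⟧))))
          (trans (∑-*ˡ C (n * n) _) (cong (n * n *_) (∑-*ˡ C m α)))))
        (∑-const-valid vC (n * n * ∑ D β))))
      where
      row : ∀ a → ∑ D (λ b → cube n + gap n * ⟦ a ≟ b ⟧ + n * n * α a + n * n * β b) ≡
        m * cube n + gap n * ⟦ a ∈? D ⟧ + n * n * (m * α a) + n * n * ∑ D β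
      row a = trans (∑-+ D _ _) (cong₂ _+_
        (trans (∑-+ D _ _) (cong₂ _+_
          (trans (∑-+ D _ _) (cong₂ _+_ (∑-const-valid vD (cube n))
            (trans (∑-*ˡ D (gap n) _) (cong (gap n *_) (∑-δ (proj₁ vD) a)))))
          (trans (∑-*ˡ D (n * n) _) (cong (n * n *_) (∑-const-valid vD (α a))))))
        (∑-*ˡ D (n * n) β))
    3g≤ : 3 * g ≤ ∑ C α + ∑ D β
    3g≤ = begin
      3 * g
        ≡⟨ triple g ⟩
      g + g + g
        ≤⟨ +-mono-≤ (+-mono-≤ (∑-missing vC vD v₁) (∑-missing vC vD v₂)) (∑-missing vC vD v₃) ⟩
      (a₁ + b₁) + (a₂ + b₂) + (a₃ + b₃)
        ≡⟨ collect a₁ b₁ a₂ b₂ a₃ b₃ ⟩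
      (a₁ + a₂ + a₃) + (b₁ + b₂ + b₃)
        ≡⟨ cong₂ _+_ (trans (cong (_+ a₃) (sym (∑-+ C _ _))) (sym (∑-+ C _ _)))
                     (trans (cong (_+ b₃) (sym (∑-+ D _ _))) (sym (∑-+ D _ _))) ⟩
      ∑ C α + ∑ D β ∎
      where
      a₁ = ∑ C (avoids L₁)
      a₂ = ∑ C (avoids L₂)
      a₃ = ∑ C (avoids L₃)
      b₁ = ∑ D (λ y → avoids L₁ y * avoids C y)
      b₂ = ∑ D (λ y → avoids L₂ y * avoids C y)
      b₃ = ∑ D (λ y → avoids L₃ y * avoids C y)
      triple : ∀ g → 3 * g ≡ g + g + g
      triple = solve-∀
      collect : ∀ a₁ b₁ a₂ b₂ a₃ b₃ →
        (a₁ + b₁) + (a₂ + b₂) + (a₃ + b₃) ≡ (a₁ + a₂ + a₃) + (b₁ + b₂ + b₃)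
      collect = solve-∀
    -- This is where `n ≥ 1` enters: at `n = 1` it reads `7 ≤ 9`, at `n = 0` it would read `1 ≤ 0`.
    gap≤ : gap n ≤ n * n * (m * 3)
    gap≤ = ≤-trans (m≤m+n (gap n) _) (≤-reflexive (sym (excess j)))
      where
      excess : ∀ j → suc j * suc j * (suc (suc (suc j)) * 3) ≡
        (3 * (suc j * suc j) + 3 * suc j + 1) + (2 + 12 * j + 12 * (j * j) + 3 * (j * j * j))
      excess = solve-∀
    compensate : gap n * (s + g) ≤ gap n * s + n * n * (m * (∑ C α + ∑ D β))
    compensate = begin
      gap n * (s + g)
        ≡⟨ *-distribˡ-+ (gap n) s g ⟩
      gap n * s + gap n * g
        ≤⟨ +-monoʳ-≤ (gap n * s) (*-monoˡ-≤ g gap≤) ⟩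
      gap n * s + n * n * (m * 3) * g
        ≡⟨ cong (gap n * s +_) (shift (n * n) m g) ⟩
      gap n * s + n * n * (m * (3 * g))
        ≤⟨ +-monoʳ-≤ (gap n * s) (*-monoʳ-≤ (n * n) (*-monoʳ-≤ m 3g≤)) ⟩
      gap n * s + n * n * (m * (∑ C α + ∑ D β)) ∎
      where
      shift : ∀ x m g → x * (m * 3) * g ≡ x * (m * (3 * g))
      shift = solve-∀
    product-≥ : ∀ n x y z → n * n * n + n * n * (x + y + z) ≤ (n + x) * (n + y) * (n + z)
    product-≥ n x y z = ≤-trans (m≤m+n _ (n * (x * y + y * z + z * x) + x * y * z))
      (≤-reflexive (expand n x y z))
      where
      expand : ∀ n x y z → n * n * n + n * n * (x + y + z) + (n * (x * y + y * z + z * x) + x * y * z)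
                         ≡ (n + x) * (n + y) * (n + z)
      expand = solve-∀
    pointwise : ∀ a b → a ∈ C → cube n + gap n * ⟦ a ≟ b ⟧ + n * n * α a + n * n * β b ≤
                                middle L₁ a b * middle L₂ a b * middle L₃ a b
    pointwise a b a∈C with a ≟ b
    ... | yes refl = begin
      cube n + gap n * ⟦ a ≟ a ⟧ + n * n * α a + n * n * β a
        ≡⟨ cong₂ (λ e f → cube n + gap n * e + n * n * α a + n * n * f)
             (⟦⟧-true (a ≟ a) refl) β≡0 ⟩
      cube n + gap n * 1 + n * n * α a + n * n * 0
        -- This raises the coefficient of `α a` from `n * n` to `suc n * suc n`.
        ≤⟨ m≤m+n _ ((2 * n + 1) * α a) ⟩
      cube n + gap n * 1 + n * n * α a + n * n * 0 + (2 * n + 1) * α a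
        ≡⟨ widen n (α a) ⟩
      suc n * suc n * suc n + suc n * suc n * α a
        ≤⟨ product-≥ (suc n) (avoids L₁ a) (avoids L₂ a) (avoids L₃ a) ⟩
      (suc n + avoids L₁ a) * (suc n + avoids L₂ a) * (suc n + avoids L₃ a)
        ≡⟨ cong₂ _*_ (cong₂ _*_ (diagonal v₁) (diagonal v₂)) (diagonal v₃) ⟨
      middle L₁ a a * middle L₂ a a * middle L₃ a a ∎
      where
      β≡0 : β a ≡ 0
      β≡0 rewrite ⟦⟧-false (¬? (a ∈? C)) (λ a∉C → a∉C a∈C)
                | *-zeroʳ (avoids L₁ a) | *-zeroʳ (avoids L₂ a) | *-zeroʳ (avoids L₃ a) = refl
      widen : ∀ n x → n * n * n + (3 * (n * n) + 3 * n + 1) * 1 + n * n * x + n * n * 0 + (2 * n + 1) * x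
                    ≡ suc n * suc n * suc n + suc n * suc n * x
      widen = solve-∀
      diagonal : ∀ {L} → Valid m L → middle L a a ≡ suc n + avoids L a
      diagonal {L} vL = trans (middle-formula vL a a)
        (sel-≡ (suc n + avoids L a) (n + avoids L a + avoids L a) a)
    ... | no a≢b = begin
      cube n + gap n * ⟦ a ≟ b ⟧ + n * n * α a + n * n * β b
        ≡⟨ cong (λ e → cube n + gap n * e + n * n * α a + n * n * β b) (⟦⟧-false (a ≟ b) a≢b) ⟩
      cube n + gap n * 0 + n * n * α a + n * n * β b
        ≡⟨ merge n (gap n) (avoids L₁ a) (avoids L₂ a) (avoids L₃ a)
                 (avoids L₁ b * avoids C b) (avoids L₂ b * avoids C b) (avoids L₃ b * avoids C b) ⟩
      n * n * n + n * n * (x L₁ + x L₂ + x L₃)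
        ≤⟨ product-≥ n (x L₁) (x L₂) (x L₃) ⟩
      (n + x L₁) * (n + x L₂) * (n + x L₃)
        ≤⟨ *-mono-≤ (*-mono-≤ (off-diagonal v₁) (off-diagonal v₂)) (off-diagonal v₃) ⟩
      middle L₁ a b * middle L₂ a b * middle L₃ a b ∎
      where
      x : List ℕ → ℕ
      x L = avoids L a + avoids L b * avoids C b
      merge : ∀ n q a₁ a₂ a₃ b₁ b₂ b₃ →
        n * n * n + q * 0 + n * n * (a₁ + a₂ + a₃) + n * n * (b₁ + b₂ + b₃) ≡
        n * n * n + n * n * (a₁ + b₁ + (a₂ + b₂) + (a₃ + b₃))
      merge = solve-∀
      off-diagonal : ∀ {L} → Valid m L → n + x L ≤ middle L a b
      off-diagonal {L} vL = begin
        n + (avoids L a + avoids L b * avoids C b)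
          ≤⟨ +-monoʳ-≤ n (+-monoʳ-≤ (avoids L a)
               (≤-trans (*-monoʳ-≤ (avoids L b) (⟦⟧≤1 (¬? (b ∈? C)))) (≤-reflexive (*-identityʳ _)))) ⟩
        n + (avoids L a + avoids L b)
          ≡⟨ +-assoc n _ _ ⟨
        n + avoids L a + avoids L b
          ≡⟨ trans (middle-formula vL a b)
               (sel-≢ (suc n + avoids L a) (n + avoids L a + avoids L b) a≢b) ⟨
        middle L a b ∎

-- Θ(2, 2, 2) with two colours.

everyBool : ∀ n → (Vec Bool n → Bool) → Bool
everyBool zero    f = f Vec.[]
everyBool (suc n) f = everyBool n (λ v → f (false Vec.∷ v)) ∧ everyBool n (λ v → f (true Vec.∷ v))

everyBool-sound : ∀ n (f : Vec Bool n → Bool) → T (everyBool n f) → ∀ v → T (f v)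
everyBool-sound zero    f t Vec.[] = t
everyBool-sound (suc n) f t (false Vec.∷ v) =
  everyBool-sound n _ (proj₁ (Equivalence.to T-∧ t)) v
everyBool-sound (suc n) f t (true Vec.∷ v) =
  everyBool-sound n _ (proj₂ (Equivalence.to (T-∧ {everyBool n (λ w → f (false Vec.∷ w))}) t)) v

bit : Bool → ℕ
bit b = if b then 1 else 0

-- For C = {c₁, c₂} and D = {d₁, d₂}, the bit eᵢⱼ says that cᵢ = dⱼ, and xᵢ (yⱼ)
-- that cᵢ (dⱼ) is not in the list of a given middle vertex.
middleᵇ : Bool → Bool → Bool → ℕ
middleᵇ e x y = if e then suc (bit x) else bit x + bit y

-- `∑-missing` in terms of bits, where `gⱼ` says that `dⱼ` is not in `C`. Each `+ 0` mirrors the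
-- unfolding of `∑` over two entries.
missingᵇ : (e₁₁ e₁₂ e₂₁ e₂₂ x₁ x₂ y₁ y₂ : Bool) → Bool
missingᵇ e₁₁ e₁₂ e₂₁ e₂₂ x₁ x₂ y₁ y₂ =
  g₁ + (g₂ + 0) ≤ᵇ bit x₁ + (bit x₂ + 0) + (bit y₁ * g₁ + (bit y₂ * g₂ + 0))
  where
  g₁ = bit (not (e₁₁ ∨ e₂₁))
  g₂ = bit (not (e₁₂ ∨ e₂₂))

K₂₃-checkᵇ : Vec Bool 16 → Bool
K₂₃-checkᵇ (e₁₁ Vec.∷ e₁₂ Vec.∷ e₂₁ Vec.∷ e₂₂ Vec.∷ x₁ Vec.∷ x₂ Vec.∷ y₁ Vec.∷ y₂ Vec.∷
            x₁′ Vec.∷ x₂′ Vec.∷ y₁′ Vec.∷ y₂′ Vec.∷ x₁″ Vec.∷ x₂″ Vec.∷ y₁″ Vec.∷ y₂″ Vec.∷ Vec.[]) =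
  not (missingᵇ e₁₁ e₁₂ e₂₁ e₂₂ x₁ x₂ y₁ y₂) ∨
  (not (missingᵇ e₁₁ e₁₂ e₂₁ e₂₂ x₁′ x₂′ y₁′ y₂′) ∨
  (not (missingᵇ e₁₁ e₁₂ e₂₁ e₂₂ x₁″ x₂″ y₁″ y₂″) ∨
  (2 ≤ᵇ
    (middleᵇ e₁₁ x₁ y₁ * middleᵇ e₁₁ x₁′ y₁′ * middleᵇ e₁₁ x₁″ y₁″ +
     (middleᵇ e₁₂ x₁ y₂ * middleᵇ e₁₂ x₁′ y₂′ * middleᵇ e₁₂ x₁″ y₂″ + 0)) +
    ((middleᵇ e₂₁ x₂ y₁ * middleᵇ e₂₁ x₂′ y₁′ * middleᵇ e₂₁ x₂″ y₁″ +
     (middleᵇ e₂₂ x₂ y₂ * middleᵇ e₂₂ x₂′ y₂′ * middleᵇ e₂₂ x₂″ y₂″ + 0)) + 0))))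

T-⇒ : ∀ {a b} → T (not a ∨ b) → T a → T b
T-⇒ {true} t _ = t

-- All 65536 bit patterns are evaluated, including those that come from no lists; the three
-- instances of `missingᵇ` exclude every pattern with a smaller sum.
K₂₃-check : ∀ v → T (K₂₃-checkᵇ v)
K₂₃-check = everyBool-sound 16 K₂₃-checkᵇ tt

K₂₃-bound-2 : ∀ {C D L₁ L₂ L₃} → Valid 2 C → Valid 2 D → Valid 2 L₁ → Valid 2 L₂ → Valid 2 L₃ →
  2 ≤ ∑∑ C D (λ a b → middle L₁ a b * middle L₂ a b * middle L₃ a b)
K₂₃-bound-2 {c₁ ∷ c₂ ∷ []} {d₁ ∷ d₂ ∷ []} {L₁} {L₂} {L₃} vC@(_ , refl) vD@(_ , refl) v₁ v₂ v₃ =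
  ≤-trans (≤ᵇ⇒≤ 2 _ (T-⇒ (T-⇒ (T-⇒ (K₂₃-check bits) (missing v₁)) (missing v₂)) (missing v₃)))
          (≤-reflexive (sym (∑-cong C λ a → ∑-cong D λ b →
            cong₂ _*_ (cong₂ _*_ (middle-formula v₁ a b) (middle-formula v₂ a b))
                      (middle-formula v₃ a b))))
  where
  C = c₁ ∷ c₂ ∷ []
  D = d₁ ∷ d₂ ∷ []
  out : List ℕ → ℕ → Bool
  out L x = does (¬? (x ∈? L))
  eq : ℕ → ℕ → Bool
  eq a b = does (a ≟ b)
  bits : Vec Bool 16
  bits = eq c₁ d₁ Vec.∷ eq c₁ d₂ Vec.∷ eq c₂ d₁ Vec.∷ eq c₂ d₂ Vec.∷
    out L₁ c₁ Vec.∷ out L₁ c₂ Vec.∷ out L₁ d₁ Vec.∷ out L₁ d₂ Vec.∷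
    out L₂ c₁ Vec.∷ out L₂ c₂ Vec.∷ out L₂ d₁ Vec.∷ out L₂ d₂ Vec.∷
    out L₃ c₁ Vec.∷ out L₃ c₂ Vec.∷ out L₃ d₁ Vec.∷ out L₃ d₂ Vec.∷ Vec.[]
  avoids-C : ∀ x → avoids C x ≡ bit (not (eq c₁ x ∨ eq c₂ x))
  avoids-C x = ⟦⟧-⇔ (¬? (x ∈? C)) (¬? ((c₁ ≟ x) ⊎-dec (c₂ ≟ x))) (mk⇔
    (λ { x∉C (inj₁ refl) → x∉C (here refl) ; x∉C (inj₂ refl) → x∉C (there (here refl)) })
    (λ { ne (here refl) → ne (inj₁ refl) ; ne (there (here refl)) → ne (inj₂ refl) }))
  missing : ∀ {L} → Valid 2 L → T (missingᵇ (eq c₁ d₁) (eq c₁ d₂) (eq c₂ d₁) (eq c₂ d₂)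
                                            (out L c₁) (out L c₂) (out L d₁) (out L d₂))
  missing {L} vL = ≤⇒≤ᵇ (subst₂
    (λ g₁ g₂ → g₁ + (g₂ + 0) ≤ avoids L c₁ + (avoids L c₂ + 0) + (avoids L d₁ * g₁ + (avoids L d₂ * g₂ + 0)))
    (avoids-C d₁) (avoids-C d₂) (∑-missing vC vD vL))

-- Chromatic polynomials of theta graphs and minimality of constant lists.

χ : ℕ → ℕ → ℕ → ℕ → ℕ
χ k l₁ l₂ l₃ = suc (suc k) * (d k l₁ * d k l₂ * d k l₃ + suc k * (o k l₁ * o k l₂ * o k l₃))

oneTo : ℕ → List ℕ
oneTo = applyUpTo suc

oneTo-valid : ∀ m → Valid m (oneTo m)
oneTo-valid m = applyUpTo⁺₁ suc m (λ i<j _ → <⇒≢ i<j ∘ suc-injective) , length-applyUpTo suc m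

chromaticPolynomial-θ : ∀ p q r k →
  chromaticPolynomial (Θ (suc p) (suc q) (suc r)) (suc (suc k)) ≡ χ k (suc p) (suc q) (suc r)
chromaticPolynomial-θ p q r k = trans (#colourings-θ {p} {q} {r} (λ _ → C))
  (trans (∑-cong∈ C (λ {a} a∈C → ∑-cong∈ C (λ {b} b∈C →
    trans (cong₂ _*_ (exact {p} a∈C b∈C) (cong₂ _*_ (exact {q} a∈C b∈C) (exact {r} a∈C b∈C)))
    (trans (sym (*-assoc (K k (suc p) a b) _ _))
    (trans (cong (_* K k (suc r) a b) (sel-* (d k (suc p)) (o k (suc p)) (d k (suc q)) (o k (suc q)) a b))
           (sel-* (d k (suc p) * d k (suc q)) (o k (suc p) * o k (suc q)) (d k (suc r)) (o k (suc r)) a b))))))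
  (∑∑-sel {k} (d k (suc p) * d k (suc q) * d k (suc r)) (o k (suc p) * o k (suc q) * o k (suc r)) vC vC id))
  where
  C = oneTo (suc (suc k))
  vC = oneTo-valid (suc (suc k))
  exact : ∀ {p a b} → a ∈ C → b ∈ C → pathColourings {p} (λ _ → C) a b ≡ K k (suc p) a b
  exact {p} = pathColourings-exact {k} {p} (λ _ → C) vC (λ _ → vC) (λ _ → id)

pathColourings-monochrome : ∀ p → pathColourings {p} (λ _ → oneTo 1) 1 1 ≡ 0
pathColourings-monochrome zero    = refl
pathColourings-monochrome (suc p) = refl

chromaticPolynomial-θ-1 : ∀ p q r → chromaticPolynomial (Θ (suc p) (suc q) (suc r)) 1 ≡ 0
chromaticPolynomial-θ-1 p q r = trans (#colourings-θ {p} {q} {r} (λ _ → oneTo 1))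
  (cong (λ e → e * (pathColourings {q} (λ _ → oneTo 1) 1 1 * pathColourings {r} (λ _ → oneTo 1) 1 1) + 0 + 0)
        (pathColourings-monochrome p))

choosable : ∀ G → (∀ m L → IsAssignment G m L → chromaticPolynomial G m ≤ #colourings G L) →
            EnumerativelyChromaticChoosable G
choosable G lower m = ((λ _ → oneTo m) , (λ _ → oneTo-valid m) , refl)
  , λ { _ (L , vL , refl) → lower m L vL }

-- Stated for separate lists along the three paths, so that the paths can be permuted. It starts at
-- two colours, because with fewer the chromatic polynomial vanishes.
ConstantListsMinimal : ℕ → ℕ → ℕ → Set
ConstantListsMinimal p q r =
  ∀ k (C D : List ℕ) (M : Fin p → List ℕ) (N : Fin q → List ℕ) (R : Fin r → List ℕ) →
  Valid (suc (suc k)) C → Valid (suc (suc k)) D → (∀ i → Valid (suc (suc k)) (M i)) →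
  (∀ i → Valid (suc (suc k)) (N i)) → (∀ i → Valid (suc (suc k)) (R i)) →
  χ k (suc p) (suc q) (suc r) ≤
  ∑∑ C D (λ a b → pathColourings M a b * pathColourings N a b * pathColourings R a b)

θ-choosable : ∀ p q r → ConstantListsMinimal p q r →
  EnumerativelyChromaticChoosable (Θ (suc p) (suc q) (suc r))
θ-choosable p q r lower = choosable (Θ (suc p) (suc q) (suc r)) bound
  where
  G = Θ (suc p) (suc q) (suc r)
  bound : ∀ m L → IsAssignment G m L → chromaticPolynomial G m ≤ #colourings G L
  bound zero          L vL = z≤n
  bound (suc zero)    L vL = ≤-trans (≤-reflexive (chromaticPolynomial-θ-1 p q r)) z≤n
  bound (suc (suc k)) L vL = ≤-trans (≤-reflexive (chromaticPolynomial-θ p q r k))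
    (≤-trans (lower k (L zero) (L (suc zero)) M N R (vL zero) (vL (suc zero))
                (λ _ → vL _) (λ _ → vL _) (λ _ → vL _))
    (≤-reflexive (sym (trans (#colourings-θ {p} {q} {r} L)
      (∑-cong (L zero) λ a → ∑-cong (L (suc zero)) λ b →
        sym (*-assoc (pathColourings M a b) (pathColourings N a b) (pathColourings R a b)))))))
    where
    M = interior₁ {p} {q} {r} L
    N = interior₂ {p} {q} {r} L
    R = interior₃ {p} {q} {r} L

-- With two colours, `k = 0`, the colours alternate along a path, so the parity of its length
-- decides whether the ends agree.
d₂-odd : ∀ l → parity l ≡ 1ℙ → d 0 l ≡ 0
d₂-odd zero          ()
d₂-odd (suc zero)    _ = refl
d₂-odd (suc (suc l)) e rewrite d₂-odd l e = refl

o₂-even : ∀ l → parity l ≡ 0ℙ → o 0 l ≡ 0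
o₂-even zero          _ = refl
o₂-even (suc zero)    ()
o₂-even (suc (suc l)) e rewrite o₂-even l e = refl

-- An odd path rules out equal end colours and an even path distinct ones; mixed parities supply
-- both.
χ₂-mixed : ∀ l₁ l₂ l₃ → ¬ (parity l₁ ≡ parity l₂ × parity l₂ ≡ parity l₃) → χ 0 l₁ l₂ l₃ ≡ 0
χ₂-mixed l₁ l₂ l₃ ne = cong₂ (λ x y → 2 * (x + 1 * y))
  (product-zero (d 0) (λ l → parity l ≡ 1ℙ) d₂-odd some-odd)
  (product-zero (o 0) (λ l → parity l ≡ 0ℙ) o₂-even some-even)
  where
  product-zero : (f : ℕ → ℕ) (P : ℕ → Set) → (∀ l → P l → f l ≡ 0) →
                 P l₁ ⊎ P l₂ ⊎ P l₃ → f l₁ * f l₂ * f l₃ ≡ 0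
  product-zero f P z (inj₁ h)        rewrite z l₁ h = refl
  product-zero f P z (inj₂ (inj₁ h)) rewrite z l₂ h | *-zeroʳ (f l₁) = refl
  product-zero f P z (inj₂ (inj₂ h)) rewrite z l₃ h = *-zeroʳ (f l₁ * f l₂)
  some-odd : parity l₁ ≡ 1ℙ ⊎ parity l₂ ≡ 1ℙ ⊎ parity l₃ ≡ 1ℙ
  some-odd with parity l₁ | parity l₂ | parity l₃
  ... | 1ℙ | _  | _  = inj₁ refl
  ... | 0ℙ | 1ℙ | _  = inj₂ (inj₁ refl)
  ... | 0ℙ | 0ℙ | 1ℙ = inj₂ (inj₂ refl)
  ... | 0ℙ | 0ℙ | 0ℙ = contradiction (refl , refl) ne
  some-even : parity l₁ ≡ 0ℙ ⊎ parity l₂ ≡ 0ℙ ⊎ parity l₃ ≡ 0ℙ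
  some-even with parity l₁ | parity l₂ | parity l₃
  ... | 0ℙ | _  | _  = inj₁ refl
  ... | 1ℙ | 0ℙ | _  = inj₂ (inj₁ refl)
  ... | 1ℙ | 1ℙ | 0ℙ = inj₂ (inj₂ refl)
  ... | 1ℙ | 1ℙ | 1ℙ = contradiction (refl , refl) ne

χ₂-same : ∀ l₁ l₂ l₃ → parity l₁ ≡ parity l₂ → parity l₂ ≡ parity l₃ → χ 0 l₁ l₂ l₃ ≡ 2
χ₂-same l₁ l₂ l₃ e₁₂ e₂₃ = by-parity (parity l₁) refl
  where
  by-parity : ∀ e → parity l₁ ≡ e → χ 0 l₁ l₂ l₃ ≡ 2
  by-parity 0ℙ e₁
    rewrite d-even {0} l₁ e₁ | d-even {0} l₂ (trans (sym e₁₂) e₁)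
          | d-even {0} l₃ (trans (sym (trans e₁₂ e₂₃)) e₁)
          | o₂-even l₁ e₁ | o₂-even l₂ (trans (sym e₁₂) e₁)
          | o₂-even l₃ (trans (sym (trans e₁₂ e₂₃)) e₁) = refl
  by-parity 1ℙ e₁
    rewrite o-odd {0} l₁ e₁ | o-odd {0} l₂ (trans (sym e₁₂) e₁)
          | o-odd {0} l₃ (trans (sym (trans e₁₂ e₂₃)) e₁)
          | d₂-odd l₁ e₁ | d₂-odd l₂ (trans (sym e₁₂) e₁)
          | d₂-odd l₃ (trans (sym (trans e₁₂ e₂₃)) e₁) = refl

-- Two of three parities agree, and the paths are permuted so that these two form the cycle. At most
-- one path is a single edge, so the cycle has more than two edges.
mixed-minimal : ∀ p q r → 1 ≤ q → 1 ≤ r →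
  ¬ (parity (suc p) ≡ parity (suc q) × parity (suc q) ≡ parity (suc r)) → ConstantListsMinimal p q r
mixed-minimal p q r 1≤q 1≤r ne = bound
  where
  l₁ l₂ l₃ : ℕ
  l₁ = suc p
  l₂ = suc q
  l₃ = suc r
  swapʳ : ∀ x y z → x * y * z ≡ x * z * y
  swapʳ = solve-∀
  rotate : ∀ x y z → x * y * z ≡ y * z * x
  rotate = solve-∀
  bound : ConstantListsMinimal p q r
  bound zero    C D M N R vC vD vM vN vR = ≤-trans (≤-reflexive (χ₂-mixed l₁ l₂ l₃ ne)) z≤n
  bound (suc j) C D M N R vC vD vM vN vR with parity l₁ ℙ≟ parity l₂ | parity l₂ ℙ≟ parity l₃
  ... | yes e₁₂ | yes e₂₃ = contradiction (e₁₂ , e₂₃) ne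
  ... | yes e₁₂ | no n₂₃  = theta-bound (s≤s z≤n) M N R vM vN vR vC vD (≤-trans 1≤q (m≤n+m q p))
                              e₁₂ (λ e₁₃ → n₂₃ (trans (sym e₁₂) e₁₃))
  ... | no n₁₂  | yes e₂₃ = ≤-trans
    (≤-reflexive (cong₂ (λ x y → suc (suc k) * (x + suc k * y))
      (rotate (d k l₁) (d k l₂) (d k l₃)) (rotate (o k l₁) (o k l₂) (o k l₃))))
    (≤-trans
      (theta-bound (s≤s z≤n) N R M vN vR vM vC vD (≤-trans 1≤q (m≤m+n q r)) e₂₃ (n₁₂ ∘ sym))
      (≤-reflexive (∑-cong C λ a → ∑-cong D λ b →
        sym (rotate (pathColourings M a b) (pathColourings N a b) (pathColourings R a b)))))
    where k = suc j
  ... | no n₁₂  | no n₂₃  = ≤-trans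
    (≤-reflexive (cong₂ (λ x y → suc (suc k) * (x + suc k * y))
      (swapʳ (d k l₁) (d k l₂) (d k l₃)) (swapʳ (o k l₁) (o k l₂) (o k l₃))))
    (≤-trans
      (theta-bound (s≤s z≤n) M R N vM vR vN vC vD (≤-trans 1≤r (m≤n+m r p))
        (third (parity l₁) (parity l₂) (parity l₃) n₁₂ n₂₃) n₁₂)
      (≤-reflexive (∑-cong C λ a → ∑-cong D λ b →
        sym (swapʳ (pathColourings M a b) (pathColourings N a b) (pathColourings R a b)))))
    where
    k = suc j
    third : ∀ x y z → x ≢ y → y ≢ z → x ≡ z
    third 0ℙ 0ℙ _  n _  = contradiction refl n
    third 0ℙ 1ℙ 0ℙ _ _  = refl
    third 0ℙ 1ℙ 1ℙ _ n′ = contradiction refl n′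
    third 1ℙ 0ℙ 0ℙ _ n′ = contradiction refl n′
    third 1ℙ 0ℙ 1ℙ _ _  = refl
    third 1ℙ 1ℙ _  n _  = contradiction refl n

K₂₃-minimal : ConstantListsMinimal 1 1 1
K₂₃-minimal zero    C D M N R vC vD vM vN vR = K₂₃-bound-2 vC vD (vM zero) (vN zero) (vR zero)
K₂₃-minimal (suc j) C D M N R vC vD vM vN vR =
  ≤-trans (≤-reflexive (cong₂ (λ x y → suc (suc (suc j)) * (x * x * x + suc (suc j) * (y * y * y)))
            (d₂ (suc j)) (o₂ (suc j))))
          (K₂₃-bound-≥3 vC vD (vM zero) (vN zero) (vR zero))
  where
  -- For paths of length two, `d` is `k + 1` and `o` is `k`.
  d₂ : ∀ k → suc k * suc (k * 0) ≡ suc k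
  d₂ = solve-∀
  o₂ : ∀ k → k * 0 + k * suc (k * 0) ≡ k
  o₂ = solve-∀

-- Lists of size two with too few colourings.

pathColourings-cong : ∀ {p} {M N : Fin p → List ℕ} → M ≗ N → ∀ a b →
                      pathColourings M a b ≡ pathColourings N a b
pathColourings-cong {zero}  e a b = refl
pathColourings-cong {suc p} {M} {N} e a b = trans
  (∑-cong (M zero) (λ c → cong (a ≠ⁿ c *_) (pathColourings-cong (e ∘ suc) c b)))
  (cong (λ L → ∑ L (λ c → a ≠ⁿ c * pathColourings (N ∘ suc) c b)) (e zero))

module _ {p q r : ℕ} (C D : List ℕ)
         (M : Fin p → List ℕ) (N : Fin q → List ℕ) (R : Fin r → List ℕ) where
  θ-lists : ListAssignment (Θ (suc p) (suc q) (suc r))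
  θ-lists = C ◂ (D ◂ (M Vector.++ (N Vector.++ R)))

  θ-lists-colourings : #colourings (Θ (suc p) (suc q) (suc r)) θ-lists ≡
    ∑∑ C D (λ a b → pathColourings M a b * (pathColourings N a b * pathColourings R a b))
  θ-lists-colourings = trans (#colourings-θ {p} {q} {r} θ-lists)
    (∑-cong C λ a → ∑-cong D λ b → cong₂ _*_
      (pathColourings-cong (lookup-++ˡ M (N Vector.++ R)) a b)
      (cong₂ _*_
        (pathColourings-cong (λ i → trans (lookup-++ʳ M (N Vector.++ R) _) (lookup-++ˡ N R i)) a b)
        (pathColourings-cong (λ i → trans (lookup-++ʳ M (N Vector.++ R) _) (lookup-++ʳ N R i)) a b)))

++-valid : ∀ {m p q} (M : Fin p → List ℕ) (N : Fin q → List ℕ) →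
  (∀ i → Valid m (M i)) → (∀ i → Valid m (N i)) → ∀ i → Valid m ((M Vector.++ N) i)
++-valid {m} {p} M N vM vN i = at-split (splitAt p i)
  where
  at-split : ∀ s → Valid m ([ M , N ]′ s)
  at-split (inj₁ i₁) = vM i₁
  at-split (inj₂ i₂) = vN i₂

-- For equal parities, constant lists of size two have exactly two colourings, so `few` beats them.
record BadLists (p q r : ℕ) : Set where
  constructor bad
  field
    C D : List ℕ
    M   : Fin p → List ℕ
    N   : Fin q → List ℕ
    R   : Fin r → List ℕ
    vC  : Valid 2 C
    vD  : Valid 2 D
    vM  : ∀ i → Valid 2 (M i)
    vN  : ∀ i → Valid 2 (N i)
    vR  : ∀ i → Valid 2 (R i)
    few : ∑∑ C D (λ a b → pathColourings M a b * (pathColourings N a b * pathColourings R a b)) < 2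

not-choosable : ∀ {p q r} → BadLists p q r →
  parity (suc p) ≡ parity (suc q) → parity (suc q) ≡ parity (suc r) →
  ¬ EnumerativelyChromaticChoosable (Θ (suc p) (suc q) (suc r))
not-choosable {p} {q} {r} (bad C D M N R vC vD vM vN vR few) e₁₂ e₂₃ ecc = <⇒≱ few (≤-trans
  (≤-reflexive (sym (trans (chromaticPolynomial-θ p q r 0) (χ₂-same (suc p) (suc q) (suc r) e₁₂ e₂₃))))
  (≤-trans (proj₂ (ecc 2) _ (θ-lists C D M N R , valid , refl))
           (≤-reflexive (θ-lists-colourings C D M N R))))
  where
  valid : ∀ i → Valid 2 (θ-lists C D M N R i)
  valid zero          = vC
  valid (suc zero)    = vD
  valid (suc (suc i)) = ++-valid M (N Vector.++ R) vM (++-valid N R vN vR) i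

∑∑-*-comm : ∀ C D (f g h : ℕ → ℕ → ℕ) →
  ∑∑ C D (λ a b → f a b * (g a b * h a b)) ≡ ∑∑ C D (λ a b → f a b * (h a b * g a b))
∑∑-*-comm C D f g h = ∑-cong C λ a → ∑-cong D λ b → cong (f a b *_) (*-comm (g a b) (h a b))

bad-swap : ∀ {p q r} → BadLists p q r → BadLists p r q
bad-swap (bad C D M N R vC vD vM vN vR few) = bad C D M R N vC vD vM vR vN
  (subst (_< 2) (∑∑-*-comm C D (pathColourings M) (pathColourings N) (pathColourings R)) few)

pair-valid : ∀ {x y} → x ≢ y → Valid 2 (x ∷ y ∷ [])
pair-valid x≢y = ((x≢y ∷ []) ∷ [] ∷ []) , refl

-- The lists {x, 2}, {2, y} force a path entered with colour x to continue with
-- 2 and then y.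
detour : ∀ {n} → ℕ → ℕ → (Fin n → List ℕ) → Fin (suc (suc n)) → List ℕ
detour x y M = (x ∷ 2 ∷ []) ◂ ((2 ∷ y ∷ []) ◂ M)

detour-valid : ∀ {n x y} {M : Fin n → List ℕ} → x ≢ 2 → 2 ≢ y → (∀ i → Valid 2 (M i)) →
               ∀ i → Valid 2 (detour x y M i)
detour-valid x≢2 2≢y vM zero          = pair-valid x≢2
detour-valid x≢2 2≢y vM (suc zero)    = pair-valid 2≢y
detour-valid x≢2 2≢y vM (suc (suc i)) = vM i

forced : ∀ {n x y b} {M : Fin (suc n) → List ℕ} → x ≢ y → M zero ≡ x ∷ y ∷ [] ⊎ M zero ≡ y ∷ x ∷ [] →
         pathColourings M x b ≡ pathColourings (M ∘ suc) y b
forced {x = x} {y} x≢y (inj₁ e) rewrite e | ≠ⁿ-refl x | ≠ⁿ-≢ x≢y =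
  trans (+-identityʳ _) (+-identityʳ _)
forced {x = x} {y} x≢y (inj₂ e) rewrite e | ≠ⁿ-refl x | ≠ⁿ-≢ x≢y =
  trans (+-identityʳ _) (+-identityʳ _)

detour-forced : ∀ {n x y b} {M : Fin n → List ℕ} → x ≢ 2 → 2 ≢ y →
                pathColourings (detour x y M) x b ≡ pathColourings M y b
detour-forced {x = x} {y} {b} {M} x≢2 2≢y =
  trans (forced {M = detour x y M} x≢2 (inj₁ refl))
        (forced {M = (2 ∷ y ∷ []) ◂ M} 2≢y (inj₁ refl))

constant-exact : ∀ p {C a b} → Valid 2 C → a ∈ C → b ∈ C →
                 pathColourings {p} (λ _ → C) a b ≡ K 0 (suc p) a b
constant-exact p {C} vC = pathColourings-exact {0} {p} (λ _ → C) vC (λ _ → vC) (λ _ → id)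

-- With two colours, walks of equal parity from different colours end in different colours, so no
-- common end `b` serves both.
K₂-clash : ∀ l l′ → parity l ≡ parity l′ → ∀ {x y b} → x ≢ y → b ≡ x ⊎ b ≡ y →
           K 0 l x b * K 0 l′ y b ≡ 0
K₂-clash l l′ e {x} {y} x≢y (inj₁ refl)
  rewrite sel-≡ (d 0 l) (o 0 l) x | sel-≢ (d 0 l′) (o 0 l′) (x≢y ∘ sym) = by-parity (parity l) refl
  where
  by-parity : ∀ f → parity l ≡ f → d 0 l * o 0 l′ ≡ 0
  by-parity 0ℙ f rewrite o₂-even l′ (trans (sym e) f) = *-zeroʳ (d 0 l)
  by-parity 1ℙ f rewrite d₂-odd l f = refl
K₂-clash l l′ e {x} {y} x≢y (inj₂ refl)
  rewrite sel-≡ (d 0 l′) (o 0 l′) y | sel-≢ (d 0 l) (o 0 l) x≢y = by-parity (parity l) refl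
  where
  by-parity : ∀ f → parity l ≡ f → o 0 l * d 0 l′ ≡ 0
  by-parity 0ℙ f rewrite o₂-even l f = refl
  by-parity 1ℙ f rewrite d₂-odd l′ (trans (sym e) f) = *-zeroʳ (o 0 l)

-- With all end lists {0, 1} and a constant first path, the detours on the other
-- paths are incompatible with the first one, for colour 0 resp. 1 at the start.
two-long-paths : ∀ p n n′ → parity (suc p) ≡ parity (suc n) → parity (suc n) ≡ parity (suc n′) →
  BadLists p (suc (suc n)) (suc (suc n′))
two-long-paths p n n′ e₁₂ e₂₃ = bad C C M N R vC vC (λ _ → vC)
  (detour-valid (λ ()) (λ ()) (λ _ → vC)) (detour-valid (λ ()) (λ ()) (λ _ → vC))
  (≤-trans (s≤s (≤-reflexive (trans (∑-cong∈ C (λ a∈C → trans (∑-cong∈ C (λ b∈C → entry a∈C b∈C)) (∑-zero C)))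
                                    (∑-zero C)))) (s≤s z≤n))
  where
  C : List ℕ
  C = 0 ∷ 1 ∷ []
  vC : Valid 2 C
  vC = pair-valid (λ ())
  M : Fin p → List ℕ
  M _ = C
  -- The detour takes up two edges, so the remaining `n + 1` have the parity of the whole path.
  N : Fin (suc (suc n)) → List ℕ
  N = detour 0 1 (λ _ → C)
  R : Fin (suc (suc n′)) → List ℕ
  R = detour 1 0 (λ _ → C)
  0∈ : 0 ∈ C
  0∈ = here refl
  1∈ : 1 ∈ C
  1∈ = there (here refl)
  0or1 : ∀ {b} → b ∈ C → b ≡ 0 ⊎ b ≡ 1
  0or1 (here e)         = inj₁ e
  0or1 (there (here e)) = inj₂ e
  entry : ∀ {a b} → a ∈ C → b ∈ C →
          pathColourings M a b * (pathColourings N a b * pathColourings R a b) ≡ 0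
  entry {b = b} (here refl) b∈C = trans (sym (*-assoc (pathColourings M 0 b) _ _))
    (cong (_* pathColourings R 0 b) (trans
      (cong₂ _*_ (constant-exact p vC 0∈ b∈C)
                 (trans (detour-forced {x = 0} {1} {M = λ (_ : Fin n) → C} (λ ()) (λ ())) (constant-exact n vC 1∈ b∈C)))
      (K₂-clash (suc p) (suc n) e₁₂ (λ ()) (0or1 b∈C))))
  entry {b = b} (there (here refl)) b∈C = trans (reorder (pathColourings M 1 b) _ _)
    (cong (_* pathColourings N 1 b) (trans
      (cong₂ _*_ (constant-exact p vC 1∈ b∈C)
                 (trans (detour-forced {x = 1} {0} {M = λ (_ : Fin n′) → C} (λ ()) (λ ())) (constant-exact n′ vC 0∈ b∈C)))
      (K₂-clash (suc p) (suc n′) (trans e₁₂ e₂₃) (λ ()) (swap (0or1 b∈C)))))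
    where
    reorder : ∀ x y z → x * (y * z) ≡ x * z * y
    reorder = solve-∀

module _ (n : ℕ) (even : parity n ≡ 0ℙ) where
  private
    C D : List ℕ
    C = 0 ∷ 1 ∷ []
    D = 0 ∷ 2 ∷ []

    -- End colours 1 and 2 exhaust the list {1, 2}, and end colours 1 and 0 exhaust {0, 1}; so the
    -- first end must be coloured 0.
    N₁ N₂ : Fin (suc zero) → List ℕ
    N₁ _ = 1 ∷ 2 ∷ []
    N₂ _ = C

    -- From colour 0 the long path is forced through 2 and 1 back to 0. The remaining `n + 1` edges,
    -- an odd number, alternate between 0 and 2, so the second end cannot be 0.
    tail : Fin (suc n) → List ℕ
    tail = (1 ∷ 0 ∷ []) ◂ (λ _ → D)

    N₃ : Fin (suc (suc (suc n))) → List ℕ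
    N₃ = detour 0 1 tail

    vD : Valid 2 D
    vD = pair-valid (λ ())

    v₁ : ∀ i → Valid 2 (N₁ i)
    v₁ _ = pair-valid (λ ())

    v₂ : ∀ i → Valid 2 (N₂ i)
    v₂ _ = pair-valid (λ ())

    v₃ : ∀ i → Valid 2 (N₃ i)
    v₃ = detour-valid (λ ()) (λ ()) λ { zero → pair-valid (λ ()) ; (suc _) → vD }

    odd : parity (suc n) ≡ 1ℙ
    odd = odd-suc (parity (suc n)) refl
      where
      odd-suc : ∀ f → parity (suc n) ≡ f → parity (suc n) ≡ 1ℙ
      odd-suc 0ℙ f = contradiction (trans (sym even) (parity-pred n f)) (λ ())
      odd-suc 1ℙ f = f

    N₃-forced : ∀ {b} → b ∈ D → pathColourings N₃ 0 b ≡ K 0 (suc n) 0 b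
    N₃-forced b∈D = trans (detour-forced {x = 0} {1} {M = tail} (λ ()) (λ ()))
      (trans (forced {x = 1} {0} {M = tail} (λ ()) (inj₁ refl)) (constant-exact n vD (here refl) b∈D))

    N₃-00 : pathColourings N₃ 0 0 ≡ 0
    N₃-00 = trans (N₃-forced (here refl)) (d₂-odd (suc n) odd)

    N₃-02 : pathColourings N₃ 0 2 ≡ 1
    N₃-02 = trans (N₃-forced (there (here refl)))
      (trans (o-odd {0} (suc n) odd) (cong suc (d₂-odd (suc n) odd)))

    -- The only colouring has 0 and 2 at the end vertices.
    one : (f : ℕ → ℕ → ℕ) → f 0 0 ≡ 0 → f 0 2 ≡ 1 →
          ∑∑ C D (λ a b → pathColourings N₁ a b * (pathColourings N₂ a b * f a b)) < 2
    one f f₀₀ f₀₂ = ≤-reflexive (cong suc count)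
      where
      count : ∑∑ C D (λ a b → pathColourings N₁ a b * (pathColourings N₂ a b * f a b)) ≡ 1
      -- The values `f 1 0` and `f 1 2` stay unknown, but are multiplied by zero.
      count rewrite f₀₀ | f₀₂ = refl

    few : ∑∑ C D (λ a b → pathColourings N₁ a b * (pathColourings N₂ a b * pathColourings N₃ a b)) < 2
    few = one (pathColourings N₃) N₃-00 N₃-02

  one-long-path : BadLists 1 1 (suc (suc (suc n)))
  one-long-path = bad C D N₁ N₂ N₃ (pair-valid (λ ())) vD v₁ v₂ v₃ few

-- If the last two lengths are at least 3, both have room for a detour. Otherwise one of them is 2;
-- minimality and parity force the first to be 2, and the remaining one is even and, not being 2, at
-- least 4.
bad-lists : ∀ p q r → p ≤ suc q → p ≤ suc r →
  parity (suc p) ≡ parity (suc (suc q)) → parity (suc (suc q)) ≡ parity (suc (suc r)) →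
  ¬ (suc p ≡ 2 × suc (suc q) ≡ 2 × suc (suc r) ≡ 2) → BadLists p (suc q) (suc r)
bad-lists p (suc n) (suc n′) _ _ e₁₂ e₂₃ _ = two-long-paths p n n′ e₁₂ e₂₃
bad-lists zero          zero r             _ _ () _ _
bad-lists (suc zero)    zero zero          _ _ _ _ n222 = contradiction (refl , refl , refl) n222
bad-lists (suc zero)    zero (suc zero)    _ _ _ () _
bad-lists (suc zero)    zero (suc (suc n)) _ _ _ e _ = one-long-path n (sym e)
bad-lists (suc (suc p)) zero r             (s≤s ()) _ _ _ _
bad-lists zero          (suc q)       zero _ _ e₁₂ e₂₃ _ = contradiction (trans e₁₂ e₂₃) (λ ())
bad-lists (suc zero)    (suc zero)    zero _ _ () _ _
bad-lists (suc zero)    (suc (suc n)) zero _ _ e _ _ = bad-swap (one-long-path n (sym e))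
bad-lists (suc (suc p)) (suc q)       zero _ (s≤s ()) _ _ _

222-minimal : ∀ {p q r} → suc p ≡ 2 × suc q ≡ 2 × suc r ≡ 2 → ConstantListsMinimal p q r
222-minimal (refl , refl , refl) = K₂₃-minimal

-- The two directions of the equivalence.

module _ (p q r : ℕ) where
  private
    SameParity Not222 : Set
    SameParity = parity (suc p) ≡ parity (suc (suc q)) × parity (suc (suc q)) ≡ parity (suc (suc r))
    Not222     = ¬ (suc p ≡ 2 × suc (suc q) ≡ 2 × suc (suc r) ≡ 2)

  -- Proved by contraposition from the two minimality results; decidability of parity equality
  -- removes the double negation.
  not-choosable⇒ : ¬ EnumerativelyChromaticChoosable (Θ (suc p) (suc (suc q)) (suc (suc r))) →
                   SameParity × Not222
  not-choosable⇒ ¬ecc =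
    decidable-stable ((parity (suc p) ℙ≟ parity (2 + q)) ×-dec (parity (2 + q) ℙ≟ parity (2 + r)))
      (λ mixed → ¬ecc (θ-choosable p (suc q) (suc r)
        (mixed-minimal p (suc q) (suc r) (s≤s z≤n) (s≤s z≤n) mixed)))
    , λ 222≡ → ¬ecc (θ-choosable p (suc q) (suc r) (222-minimal 222≡))

  ⇒not-choosable : suc p ≡ suc p ⊓ suc (suc q) ⊓ suc (suc r) → SameParity × Not222 →
                   ¬ EnumerativelyChromaticChoosable (Θ (suc p) (suc (suc q)) (suc (suc r)))
  ⇒not-choosable min ((e₁₂ , e₂₃) , n222) = not-choosable {p} {suc q} {suc r} (bad-lists p q r
    (s≤s⁻¹ (≤-trans (≤-reflexive min) (≤-trans (m⊓n≤m (suc p ⊓ (2 + q)) (2 + r)) (m⊓n≤n (suc p) (2 + q)))))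
    (s≤s⁻¹ (≤-trans (≤-reflexive min) (m⊓n≤n (suc p ⊓ (2 + q)) (2 + r))))
    e₁₂ e₂₃ n222) e₁₂ e₂₃

-- Transporting along this equation keeps the type checker from unfolding the
-- two graphs inside EnumerativelyChromaticChoosable in order to compare them.
Θ-irrelevant : ∀ p q r .(i₁ : NonZero (suc p)) .(i₂ : NonZero (suc q)) .(i₃ : NonZero (suc r)) →
  Θ (suc p) (suc q) (suc r) ≡ Θ (suc p) (suc q) (suc r) {{i₁}} {{i₂}} {{i₃}}
Θ-irrelevant p q r i₁ i₂ i₃ = refl

theorem1p4 : (l₁ l₂ l₃ : ℕ) .{{_ : NonZero l₁}} .{{_ : NonZero l₂}} .{{_ : NonZero l₃}} →
    l₁ ≡ l₁ ⊓ l₂ ⊓ l₃ → l₂ ≥ 2 → l₃ ≥ 2 →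
    (¬ EnumerativelyChromaticChoosable (Θ l₁ l₂ l₃)) ⇔
    ((parity l₁ ≡ parity l₂ × parity l₂ ≡ parity l₃) ×
    ¬ (l₁ ≡ 2 × l₂ ≡ 2 × l₃ ≡ 2))
theorem1p4 zero _ _ {{nz}} _ _ _ = contradiction refl (≢-nonZero⁻¹ 0 {{nz}})
theorem1p4 (suc p) _ _ {{i₁}} {{i₂}} {{i₃}} min (s≤s (s≤s {n = q} z≤n)) (s≤s (s≤s {n = r} z≤n)) =
  subst (λ G → (¬ EnumerativelyChromaticChoosable G) ⇔
               ((parity (suc p) ≡ parity (suc (suc q)) × parity (suc (suc q)) ≡ parity (suc (suc r))) ×
                ¬ (suc p ≡ 2 × suc (suc q) ≡ 2 × suc (suc r) ≡ 2)))
        (Θ-irrelevant p (suc q) (suc r) i₁ i₂ i₃)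
        (mk⇔ (not-choosable⇒ p q r) (⇒not-choosable p q r min))
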